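{- $F_{\mathrm{strong}}\not\preceq\mathrm{WL}_{3/2}$: there exist graphs $G$ and $H$ with $\mathrm{WL}_{3/2}(G)=\mathrm{WL}_{3/2}(H)$ but $F_{\mathrm{strong}}(G)\ne F_{\mathrm{strong}}(H)$. Consequently also $F_{\mathrm{weak}}$ is strictly weaker than $F_{\mathrm{strong}}$ (there are graphs with equal $F_{\mathrm{weak}}$ and different $F_{\mathrm{strong}}$).
   Context: Graphs are finite, simple and undirected with adjacency matrix $A$. $\mathrm{Spec}(G)$ is the multiset of eigenvalues of $A$. Let $\mu_1<\dots<\mu_m$ be the distinct eigenvalues, $P_i$ the orthogonal projection matrix onto the eigenspace of $\mu_i$, $P_*(x,y)=(P_1(x,y),\dots,P_m(x,y))$. Fürer's strong spectral invariant is $F_{\mathrm{strong}}(G)=\big(\mathrm{Spec}(G),\{\!\{(P_*(x,x),\{\!\{(P_*(x,y),P_*(y,y))\}\!\}_{y\in V(G)})\}\!\}_{x\in V(G)}\big)$ and the weak one is $F_{\mathrm{weak}}(G)=\big(\mathrm{Spec}(G),\{\!\{(P_*(x,x),\{\!\{P_*(x,y)\}\!\}_{y})\}\!\}_{x}\big)$, where $\{\!\{\cdot\}\!\}$ denotes a multiset. Color refinement (1-WL) on a vertex-colored $n$-vertex graph: $C^0(x)$ is the color of $x$ (uniform if uncolored), $C^{r+1}(x)=\big(C^r(x),\{\!\{C^r(y)\}\!\}_{y\in N(x)}\big)$; $\mathrm{WL}_1(G)=\{\!\{C^n(x)\}\!\}_{x\in V(G)}$. $G_x$ is $G$ with vertex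 $x$ individualized (given a special new color, the same for all choices of $x$). $\mathrm{WL}_{3/2}(G)=\{\!\{\mathrm{WL}_1(G_x)\}\!\}_{x\in V(G)}$. -}

module Defs where

open import Data.Bool.Base using (Bool; true; false; if_then_else_)
open import Data.Fin.Base as Fin using (Fin)
open import Data.Fin.Properties using (_≟_)
open import Data.List.Base using (List; allFin; concat; filterᵇ; map; replicate; tabulate)
open import Data.List.Relation.Binary.Permutation.Homogeneous using (Permutation)
import Data.List.Relation.Binary.Pointwise.Base as List
open import Data.Nat.Base as ℕ using (ℕ; zero; suc)
import Data.Nat.Properties as ℕ
open import Data.Product.Base using (∃; _×_; _,_; proj₁; proj₂)
import Data.Product.Relation.Binary.Pointwise.NonDependent as Product
open import Data.Rational.Base as ℚ using (ℚ; 0ℚ; 1ℚ; ½; ∣_∣)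
import Data.Rational.Properties as ℚ
open import Data.Rational.Solver using (module +-*-Solver)
open import Data.Sum.Base using (_⊎_)
open import Data.Vec.Functional using (Vector; foldr)
open import Relation.Nullary.Decidable.Core using (does)
open import Relation.Binary.PropositionalEquality using (_≡_; refl; sym; trans; cong; cong₂; subst)

------------------------------------------------------------------------
-- Real numbers: Cauchy sequences of rationals, up to _≈_

IsCauchy : (ℕ → ℚ) → Set
IsCauchy s = ∀ ε → 0ℚ ℚ.< ε →
  ∃ λ N → ∀ m n → N ℕ.≤ m → N ℕ.≤ n → ∣ s m ℚ.- s n ∣ ℚ.< ε

record ℝ : Set where
  constructor mkℝ
  field
    seq    : ℕ → ℚ
    cauchy : IsCauchy seq

open ℝ public

infix 4 _≈_ _<_ _#_

_≈_ : ℝ → ℝ → Set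
x ≈ y = ∀ ε → 0ℚ ℚ.< ε →
  ∃ λ N → ∀ n → N ℕ.≤ n → ∣ seq x n ℚ.- seq y n ∣ ℚ.< ε

_<_ : ℝ → ℝ → Set
x < y = ∃ λ ε → 0ℚ ℚ.< ε ×
  ∃ λ N → ∀ n → N ℕ.≤ n → ε ℚ.< seq y n ℚ.- seq x n

-- Apartness, i.e. the positive form of x ≠ y.
_#_ : ℝ → ℝ → Set
x # y = x < y ⊎ y < x

open ℚ.≤-Reasoning

open +-*-Solver using (solve; _:+_; _:-_; _:*_; :-_; _:=_)

+-regroup : ∀ a b c d → (a ℚ.+ b) ℚ.- (c ℚ.+ d) ≡ (a ℚ.- c) ℚ.+ (b ℚ.- d)
+-regroup = solve 4 (λ a b c d →
  (a :+ b) :- (c :+ d) := (a :- c) :+ (b :- d)) refl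

neg-regroup : ∀ a c → (ℚ.- a) ℚ.- (ℚ.- c) ≡ ℚ.- (a ℚ.- c)
neg-regroup = solve 2 (λ a c → (:- a) :- (:- c) := :- (a :- c)) refl

cancel : ∀ a c → a ≡ (a ℚ.- c) ℚ.+ c
cancel = solve 2 (λ a c → a := (a :- c) :+ c) refl

*-regroup : ∀ a b c d →
  (a ℚ.* b) ℚ.- (c ℚ.* d) ≡ (a ℚ.* (b ℚ.- d)) ℚ.+ (d ℚ.* (a ℚ.- c))
*-regroup = solve 4 (λ a b c d →
  (a :* b) :- (c :* d) := (a :* (b :- d)) :+ (d :* (a :- c))) refl

half-pos : ∀ {ε} → 0ℚ ℚ.< ε → 0ℚ ℚ.< ½ ℚ.* ε
half-pos {ε} ε>0 =
  subst (ℚ._< ½ ℚ.* ε) (ℚ.*-zeroʳ ½) (ℚ.*-monoʳ-<-pos ½ ε>0)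

half+half : ∀ ε → ½ ℚ.* ε ℚ.+ ½ ℚ.* ε ≡ ε
half+half ε = trans (sym (ℚ.*-distribʳ-+ ε ½ ½)) (ℚ.*-identityˡ ε)

0<1 : 0ℚ ℚ.< 1ℚ
0<1 = ℚ.positive⁻¹ 1ℚ

abstract
  constant-cauchy : ∀ q → IsCauchy (λ _ → q)
  constant-cauchy q ε ε>0 =
    0 , λ _ _ _ _ → subst (λ d → ∣ d ∣ ℚ.< ε) (sym (ℚ.+-inverseʳ q)) ε>0

+-close : ∀ a b c d {η θ} → ∣ a ℚ.- c ∣ ℚ.< η → ∣ b ℚ.- d ∣ ℚ.< θ →
  ∣ (a ℚ.+ b) ℚ.- (c ℚ.+ d) ∣ ℚ.< η ℚ.+ θ
+-close a b c d {η} {θ} p q = begin-strict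
  ∣ (a ℚ.+ b) ℚ.- (c ℚ.+ d) ∣  ≡⟨ cong ∣_∣ (+-regroup a b c d) ⟩
  ∣ (a ℚ.- c) ℚ.+ (b ℚ.- d) ∣  ≤⟨ ℚ.∣p+q∣≤∣p∣+∣q∣ (a ℚ.- c) (b ℚ.- d) ⟩
  ∣ a ℚ.- c ∣ ℚ.+ ∣ b ℚ.- d ∣  <⟨ ℚ.+-mono-< p q ⟩
  η ℚ.+ θ                      ∎

abstract
  +-cauchy : ∀ x y → IsCauchy (λ n → seq x n ℚ.+ seq y n)
  +-cauchy x y ε ε>0
    with cauchy x (½ ℚ.* ε) (half-pos ε>0) | cauchy y (½ ℚ.* ε) (half-pos ε>0)
  ... | N₁ , p₁ | N₂ , p₂ = N₁ ℕ.⊔ N₂ , λ m n N≤m N≤n →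
    subst (_ ℚ.<_) (half+half ε)
      (+-close (seq x m) (seq y m) (seq x n) (seq y n)
        (p₁ m n (ℕ.m⊔n≤o⇒m≤o N₁ N₂ N≤m) (ℕ.m⊔n≤o⇒m≤o N₁ N₂ N≤n))
        (p₂ m n (ℕ.m⊔n≤o⇒n≤o N₁ N₂ N≤m) (ℕ.m⊔n≤o⇒n≤o N₁ N₂ N≤n)))

neg-close : ∀ a c → ∣ (ℚ.- a) ℚ.- (ℚ.- c) ∣ ≡ ∣ a ℚ.- c ∣
neg-close a c = trans (cong ∣_∣ (neg-regroup a c)) (ℚ.∣-p∣≡∣p∣ (a ℚ.- c))

abstract
  neg-cauchy : ∀ x → IsCauchy (λ n → ℚ.- seq x n)
  neg-cauchy x ε ε>0 with cauchy x ε ε>0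
  ... | N , p = N , λ m n N≤m N≤n →
    subst (ℚ._< ε) (sym (neg-close (seq x m) (seq x n))) (p m n N≤m N≤n)

near-bound : ∀ a c → ∣ a ℚ.- c ∣ ℚ.< 1ℚ → ∣ a ∣ ℚ.≤ 1ℚ ℚ.+ ∣ c ∣
near-bound a c p = begin
  ∣ a ∣                    ≡⟨ cong ∣_∣ (cancel a c) ⟩
  ∣ (a ℚ.- c) ℚ.+ c ∣      ≤⟨ ℚ.∣p+q∣≤∣p∣+∣q∣ (a ℚ.- c) c ⟩
  ∣ a ℚ.- c ∣ ℚ.+ ∣ c ∣    ≤⟨ ℚ.+-monoˡ-≤ ∣ c ∣ (ℚ.<⇒≤ p) ⟩
  1ℚ ℚ.+ ∣ c ∣             ∎

1+abs-pos : ∀ c → 0ℚ ℚ.< 1ℚ ℚ.+ ∣ c ∣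
1+abs-pos c = ℚ.+-mono-<-≤ 0<1 (ℚ.0≤∣p∣ c)

bounded : ∀ x → ∃ λ B → 0ℚ ℚ.< B × ∃ λ N → ∀ n → N ℕ.≤ n → ∣ seq x n ∣ ℚ.≤ B
bounded x with cauchy x 1ℚ 0<1
... | N , p = 1ℚ ℚ.+ ∣ seq x N ∣ , 1+abs-pos (seq x N) ,
  N , λ n N≤n → near-bound (seq x n) (seq x N) (p n N N≤n ℕ.≤-refl)

-- δ = ε / B
quotient : ∀ B → 0ℚ ℚ.< B → ∀ ε → 0ℚ ℚ.< ε →
  ∃ λ δ → 0ℚ ℚ.< δ × B ℚ.* δ ≡ ε
quotient B B>0 ε ε>0 = δ , δ>0 , B*δ≡ε
  where
  instance
    B-pos : ℚ.Positive B
    B-pos = ℚ.positive B>0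
    B-nonZero : ℚ.NonZero B
    B-nonZero = ℚ.pos⇒nonZero B
    1/B-pos : ℚ.Positive (ℚ.1/ B)
    1/B-pos = ℚ.1/pos⇒pos B
  δ : ℚ
  δ = ℚ.1/ B ℚ.* ε
  δ>0 : 0ℚ ℚ.< δ
  δ>0 = subst (ℚ._< δ) (ℚ.*-zeroʳ (ℚ.1/ B)) (ℚ.*-monoʳ-<-pos (ℚ.1/ B) ε>0)
  B*δ≡ε : B ℚ.* δ ≡ ε
  B*δ≡ε = trans (sym (ℚ.*-assoc B (ℚ.1/ B) ε))
                (trans (cong (ℚ._* ε) (ℚ.*-inverseʳ B)) (ℚ.*-identityˡ ε))

product-bound : ∀ B δ a d → 0ℚ ℚ.< B →
  ∣ a ∣ ℚ.≤ B → ∣ d ∣ ℚ.< δ → ∣ a ℚ.* d ∣ ℚ.< B ℚ.* δ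
product-bound B δ a d B>0 a≤B d<δ = begin-strict
  ∣ a ℚ.* d ∣      ≡⟨ ℚ.∣p*q∣≡∣p∣*∣q∣ a d ⟩
  ∣ a ∣ ℚ.* ∣ d ∣  ≤⟨ ℚ.*-monoʳ-≤-nonNeg ∣ d ∣ {{ℚ.∣-∣-nonNeg d}} a≤B ⟩
  B ℚ.* ∣ d ∣      <⟨ ℚ.*-monoʳ-<-pos B {{ℚ.positive B>0}} d<δ ⟩
  B ℚ.* δ          ∎

*-close : ∀ a b c d {B C δ θ} → 0ℚ ℚ.< B → 0ℚ ℚ.< C →
  ∣ a ∣ ℚ.≤ B → ∣ d ∣ ℚ.≤ C → ∣ b ℚ.- d ∣ ℚ.< δ → ∣ a ℚ.- c ∣ ℚ.< θ →
  ∣ (a ℚ.* b) ℚ.- (c ℚ.* d) ∣ ℚ.< B ℚ.* δ ℚ.+ C ℚ.* θ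
*-close a b c d {B} {C} {δ} {θ} B>0 C>0 a≤B d≤C p q = begin-strict
  ∣ (a ℚ.* b) ℚ.- (c ℚ.* d) ∣
    ≡⟨ cong ∣_∣ (*-regroup a b c d) ⟩
  ∣ (a ℚ.* (b ℚ.- d)) ℚ.+ (d ℚ.* (a ℚ.- c)) ∣
    ≤⟨ ℚ.∣p+q∣≤∣p∣+∣q∣ (a ℚ.* (b ℚ.- d)) (d ℚ.* (a ℚ.- c)) ⟩
  ∣ a ℚ.* (b ℚ.- d) ∣ ℚ.+ ∣ d ℚ.* (a ℚ.- c) ∣
    <⟨ ℚ.+-mono-< (product-bound B δ a (b ℚ.- d) B>0 a≤B p)
                  (product-bound C θ d (a ℚ.- c) C>0 d≤C q) ⟩
  B ℚ.* δ ℚ.+ C ℚ.* θ ∎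

abstract
  *-cauchy : ∀ x y → IsCauchy (λ n → seq x n ℚ.* seq y n)
  *-cauchy x y ε ε>0 = combine (bounded x) (bounded y)
    where
    s t : ℕ → ℚ
    s = seq x
    t = seq y

    combine : (∃ λ B → 0ℚ ℚ.< B × ∃ λ N → ∀ n → N ℕ.≤ n → ∣ s n ∣ ℚ.≤ B) →
              (∃ λ C → 0ℚ ℚ.< C × ∃ λ N → ∀ n → N ℕ.≤ n → ∣ t n ∣ ℚ.≤ C) →
              ∃ λ N → ∀ m n → N ℕ.≤ m → N ℕ.≤ n →
                ∣ s m ℚ.* t m ℚ.- s n ℚ.* t n ∣ ℚ.< ε
    combine (B , B>0 , M₁ , b) (C , C>0 , M₂ , c) =
      finish (quotient B B>0 (½ ℚ.* ε) (half-pos ε>0))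
             (quotient C C>0 (½ ℚ.* ε) (half-pos ε>0))
      where
      finish : (∃ λ δ → 0ℚ ℚ.< δ × B ℚ.* δ ≡ ½ ℚ.* ε) →
               (∃ λ θ → 0ℚ ℚ.< θ × C ℚ.* θ ≡ ½ ℚ.* ε) →
               ∃ λ N → ∀ m n → N ℕ.≤ m → N ℕ.≤ n →
                 ∣ s m ℚ.* t m ℚ.- s n ℚ.* t n ∣ ℚ.< ε
      finish (δ , δ>0 , Bδ) (θ , θ>0 , Cθ) = N , close
        where
        M₀ N₁ N₂ N₀ N : ℕ
        M₀ = M₁ ℕ.⊔ M₂
        N₁ = cauchy y δ δ>0 .proj₁
        N₂ = cauchy x θ θ>0 .proj₁
        N₀ = N₁ ℕ.⊔ N₂
        N  = M₀ ℕ.⊔ N₀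

        bound : B ℚ.* δ ℚ.+ C ℚ.* θ ≡ ε
        bound = trans (cong₂ ℚ._+_ Bδ Cθ) (half+half ε)

        close : ∀ m n → N ℕ.≤ m → N ℕ.≤ n →
                ∣ s m ℚ.* t m ℚ.- s n ℚ.* t n ∣ ℚ.< ε
        close m n N≤m N≤n =
          subst (∣ s m ℚ.* t m ℚ.- s n ℚ.* t n ∣ ℚ.<_) bound
            (*-close (s m) (t m) (s n) (t n) B>0 C>0
              (b m (ℕ.m⊔n≤o⇒m≤o M₁ M₂ (ℕ.m⊔n≤o⇒m≤o M₀ N₀ N≤m)))
              (c n (ℕ.m⊔n≤o⇒n≤o M₁ M₂ (ℕ.m⊔n≤o⇒m≤o M₀ N₀ N≤n)))
              (cauchy y δ δ>0 .proj₂ m n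
                (ℕ.m⊔n≤o⇒m≤o N₁ N₂ (ℕ.m⊔n≤o⇒n≤o M₀ N₀ N≤m))
                (ℕ.m⊔n≤o⇒m≤o N₁ N₂ (ℕ.m⊔n≤o⇒n≤o M₀ N₀ N≤n)))
              (cauchy x θ θ>0 .proj₂ m n
                (ℕ.m⊔n≤o⇒n≤o N₁ N₂ (ℕ.m⊔n≤o⇒n≤o M₀ N₀ N≤m))
                (ℕ.m⊔n≤o⇒n≤o N₁ N₂ (ℕ.m⊔n≤o⇒n≤o M₀ N₀ N≤n))))

fromℚ : ℚ → ℝ
fromℚ q = mkℝ (λ _ → q) (constant-cauchy q)

0ℝ 1ℝ : ℝ
0ℝ = fromℚ 0ℚ
1ℝ = fromℚ 1ℚ

infixl 6 _+_ _-_
infixl 7 _*_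
infix  8 -_

_+_ : ℝ → ℝ → ℝ
x + y = mkℝ (λ n → seq x n ℚ.+ seq y n) (+-cauchy x y)

-_ : ℝ → ℝ
- x = mkℝ (λ n → ℚ.- seq x n) (neg-cauchy x)

_-_ : ℝ → ℝ → ℝ
x - y = x + (- y)

_*_ : ℝ → ℝ → ℝ
x * y = mkℝ (λ n → seq x n ℚ.* seq y n) (*-cauchy x y)

------------------------------------------------------------------------
-- Linear algebra over ℝ

sum : ∀ {n} → Vector ℝ n → ℝ
sum = foldr _+_ 0ℝ

Matrix : ℕ → Set
Matrix n = Fin n → Fin n → ℝ

module _ {n : ℕ} where

  _≈ᵛ_ : Vector ℝ n → Vector ℝ n → Set
  v ≈ᵛ w = ∀ x → v x ≈ w x

  ⟨_,_⟩ : Vector ℝ n → Vector ℝ n → ℝ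
  ⟨ v , w ⟩ = sum λ x → v x * w x

  _·_ : Matrix n → Vector ℝ n → Vector ℝ n
  (M · v) x = sum λ y → M x y * v y

  Eigenspace : Matrix n → ℝ → Vector ℝ n → Set
  Eigenspace M μ v = (M · v) ≈ᵛ (λ x → μ * v x)

  IsEigenvalue : Matrix n → ℝ → Set
  IsEigenvalue M μ = ∃ λ v → (∃ λ x → v x # 0ℝ) × Eigenspace M μ v

  combination : ∀ {k} → Vector ℝ k → (Fin k → Vector ℝ n) → Vector ℝ n
  combination c b x = sum λ j → c j * b j x

  record IsBasis {k} (b : Fin k → Vector ℝ n) (E : Vector ℝ n → Set) : Set where
    field
      member      : ∀ j → E (b j)
      independent : ∀ c → combination c b ≈ᵛ (λ _ → 0ℝ) → ∀ j → c j ≈ 0ℝ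
      spanning    : ∀ v → E v → ∃ λ c → v ≈ᵛ combination c b

  record IsOrthogonalProjection (P : Matrix n) (E : Vector ℝ n → Set) : Set where
    field
      image    : ∀ v → E (P · v)
      residual : ∀ v w → E w → ⟨ (λ x → v x - (P · v) x) , w ⟩ ≈ 0ℝ

------------------------------------------------------------------------
-- Graphs

record Graph : Set where
  field
    order       : ℕ
    adj         : Fin order → Fin order → Bool
    symmetric   : ∀ x y → adj x y ≡ adj y x
    irreflexive : ∀ x → adj x x ≡ false

  V : Set
  V = Fin order

  adjacency : Matrix order
  adjacency x y = if adj x y then 1ℝ else 0ℝ

  vertices : List V
  vertices = allFin order

  neighbours : V → List V
  neighbours x = filterᵇ (adj x) vertices

------------------------------------------------------------------------
-- Multisets: lists up to permutation, where R is the equality of entries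

Multiset : Set → Set
Multiset = List

SameMultiset : {A : Set} → (A → A → Set) → Multiset A → Multiset A → Set
SameMultiset R = Permutation R

------------------------------------------------------------------------
-- Spectral invariants

-- By the spectral theorem every graph has these data, and they are unique
-- up to _≈_ and the choice of bases (which serve only to count dimensions),
-- so the functions F-strong and F-weak of a decomposition are invariants of
-- the graph.
record SpectralDecomposition (G : Graph) : Set where
  open Graph G
  field
    count        : ℕ
    μ            : Fin count → ℝ
    increasing   : ∀ i j → i Fin.< j → μ i < μ j
    isEigenvalue : ∀ i → IsEigenvalue adjacency (μ i)
    exhaustive   : ∀ ν → IsEigenvalue adjacency ν → ∃ λ i → ν ≈ μ i
    multiplicity : Fin count → ℕ
    basis        : ∀ i → Fin (multiplicity i) → Vector ℝ order
    isBasis      : ∀ i → IsBasis (basis i) (Eigenspace adjacency (μ i))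
    P            : Fin count → Matrix order
    isProjection : ∀ i → IsOrthogonalProjection (P i) (Eigenspace adjacency (μ i))

  Spec : List ℝ
  Spec = concat (tabulate λ i → replicate (multiplicity i) (μ i))

  P⋆ : V → V → List ℝ
  P⋆ x y = tabulate λ i → P i x y

  F-strong : Multiset ℝ × Multiset (List ℝ × Multiset (List ℝ × List ℝ))
  F-strong = Spec , map (λ x → P⋆ x x , map (λ y → P⋆ x y , P⋆ y y) vertices) vertices

  F-weak : Multiset ℝ × Multiset (List ℝ × Multiset (List ℝ))
  F-weak = Spec , map (λ x → P⋆ x x , map (λ y → P⋆ x y) vertices) vertices

open SpectralDecomposition public using (F-strong; F-weak)

infix 4 _≈⋆_ _≈ˢ_ _≈ʷ_

_≈⋆_ : List ℝ → List ℝ → Set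
_≈⋆_ = List.Pointwise _≈_

_≈ˢ_ : (s t : Multiset ℝ × Multiset (List ℝ × Multiset (List ℝ × List ℝ))) → Set
_≈ˢ_ = Product.Pointwise (SameMultiset _≈_)
  (SameMultiset (Product.Pointwise _≈⋆_ (SameMultiset (Product.Pointwise _≈⋆_ _≈⋆_))))

_≈ʷ_ : (s t : Multiset ℝ × Multiset (List ℝ × Multiset (List ℝ))) → Set
_≈ʷ_ = Product.Pointwise (SameMultiset _≈_)
  (SameMultiset (Product.Pointwise _≈⋆_ (SameMultiset _≈⋆_)))

------------------------------------------------------------------------
-- Color refinement.  The colors of all rounds, over all graphs, share one
-- type, so that colors from different graphs can be compared.

data Color (B : Set) : Set where
  initial : B → Color B
  refined : Color B → Multiset (Color B) → Color B

infix 4 _≈ᶜ_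

data _≈ᶜ_ {B : Set} : Color B → Color B → Set where
  initial : ∀ {b c} → b ≡ c → initial b ≈ᶜ initial c
  refined : ∀ {c d cs ds} → c ≈ᶜ d → SameMultiset _≈ᶜ_ cs ds →
            refined c cs ≈ᶜ refined d ds

module _ (G : Graph) where
  open Graph G

  refine : {B : Set} → (V → B) → ℕ → V → Color B
  refine c zero    x = initial (c x)
  refine c (suc r) x = refined (refine c r x) (map (refine c r) (neighbours x))

  WL₁ : {B : Set} → (V → B) → Multiset (Color B)
  WL₁ c = map (refine c order) vertices

  -- true is the special color of x, false the color of all other vertices.
  individualize : V → V → Bool
  individualize x y = does (y ≟ x)

  WL₃/₂ : Multiset (Multiset (Color Bool))
  WL₃/₂ = map (λ x → WL₁ (individualize x)) vertices

infix 4 _≈ᵂ_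

_≈ᵂ_ : Multiset (Multiset (Color Bool)) → Multiset (Multiset (Color Bool)) → Set
_≈ᵂ_ = SameMultiset (SameMultiset _≈ᶜ_)

{-# OPTIONS --safe #-}
module Submission where

-- Four blocks of six vertices, each a hexagon or a pair of triangles, are joined
-- completely in two pairs.  Color refinement cannot tell a hexagon from a pair
-- of triangles unless a vertex inside it is individualized, so WL₃/₂ and F-weak
-- only see how many blocks of each kind there are.  F-strong records P⋆ y y
-- along with P⋆ x y, and therefore sees which kinds are joined to each other: in
-- G each hexagon is joined to a pair of triangles, in H like is joined to like.
--
-- The characters of ℤ/6 diagonalise blocks of both kinds, so both graphs have
-- an orthogonal eigenbasis with integer entries and integer eigenvalues.
-- Constructively, an arbitrary real eigenvalue ν is located by some Pᵢ v having
-- an entry apart from 0, for then (ν − μᵢ) Pᵢ v = 0 gives ν = μᵢ.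

open import Algebra.Bundles using (CommutativeRing)
import Algebra.Properties.Group as GroupProperties
import Algebra.Properties.Semiring.Sum as SemiringSum
import Algebra.Solver.Ring.NaturalCoefficients.Default as SemiringSolver
open import Data.Bool.Base using (Bool; true; false; if_then_else_; _∨_)
import Data.Bool.Properties as Bool
open import Data.Fin.Base as Fin using (Fin; zero; suc; toℕ)
open import Data.Fin.Patterns using (0F; 1F; 3F; 5F)
import Data.Fin.Properties as Fin
open import Data.Fin.Properties using (all?; any?)
open import Data.Integer.Base as ℤ using (ℤ; +_; -[1+_]; 0ℤ; 1ℤ; -1ℤ)
import Data.Integer.Properties as ℤ
open import Data.List.Base using (List; []; _∷_; _++_; allFin; concatMap; filterᵇ; length; lookup; map; replicate; tabulate; upTo)
open import Data.List.Membership.Propositional.Properties using (∈-allFin)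
open import Data.List.Properties using (map-∘; map-cong; ≡-dec)
open import Data.List.Relation.Binary.Permutation.Homogeneous as Homogeneous using (Permutation)
open import Data.List.Relation.Binary.Permutation.Propositional using (_↭_; ↭⇒↭ₛ; ↭-trans; ↭-sym; ↭-reflexive)
open import Data.List.Relation.Binary.Pointwise as Pointwise using (Pointwise; []; _∷_)
open import Data.List.Relation.Unary.Any as Any using (Any; here; there)
import Data.List.Relation.Unary.Any.Properties as Any
open import Data.Nat.Base as ℕ using (ℕ; zero; suc; _≡ᵇ_; _%_; _/_; _∸_)
import Data.Nat.Coprimality as Coprimality
open import Data.Nat.DivMod using (_mod_)
import Data.Nat.Properties as ℕ
open import Data.List.Sort.InsertionSort.Base ℕ.≤-decTotalOrder using (sort)
open import Data.List.Sort.InsertionSort.Properties ℕ.≤-decTotalOrder using (sort-↭)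
open import Data.Product.Base using (∃; Σ; _×_; _,_; proj₁; proj₂)
import Data.Product.Relation.Binary.Pointwise.NonDependent as Product
open import Data.Rational.Base as ℚ using (ℚ; mkℚ; 0ℚ; ½; ∣_∣)
import Data.Rational.Properties as ℚ
open import Data.Rational.Solver using (module +-*-Solver)
import Data.Rational.Unnormalised.Base as ℚᵘ
import Data.Rational.Unnormalised.Properties as ℚᵘ
open import Data.Sum.Base using (_⊎_; inj₁; inj₂)
open import Data.Vec.Base as Vec using (Vec; []; _∷_)
open import Data.Vec.Functional using (Vector)
open import Level using (0ℓ)
open import Relation.Binary.Core using (Rel)
open import Relation.Binary.Definitions using (Reflexive; Symmetric; tri<; tri≈; tri>)
open import Relation.Binary.PropositionalEquality as ≡ using (_≡_; _≢_; refl; cong; cong₂; subst; subst₂)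
import Relation.Binary.Reasoning.Setoid as SetoidReasoning
open import Relation.Nullary.Decidable.Core using (yes; no; does; from-yes; _→-dec_; ¬?)
open import Relation.Nullary.Negation.Core using (¬_; contradiction)

open import Defs using (Graph)

open SemiringSum ℤ.+-*-semiring using () renaming (sum to sumℤ; sum-cong-≗ to sumℤ-cong)

-- Integral eigenbases

-- Orthogonal eigenvectors b i j with integer entries, for integer eigenvalues
-- μ i.  The weight w i j is norm / ⟨ b i j , b i j ⟩, for a common multiple
-- norm of the squared lengths, so that norm · P i has integer entries.
record IntegralFrame (G : Graph) : Set where
  open Graph G
  field
    count : ℕ
    μ     : Fin count → ℤ
    mult  : Fin count → ℕ
    b     : ∀ i → Fin (mult i) → V → ℤ
    w     : ∀ i → Fin (mult i) → ℤ
    norm  : ℕ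
    {{norm-nonZero}} : ℕ.NonZero norm

  edge : V → V → ℤ
  edge x y = if adj x y then 1ℤ else 0ℤ

  scaledP : Fin count → V → V → ℤ
  scaledP i x y = sumℤ λ j → w i j ℤ.* (b i j x ℤ.* b i j y)

  field
    increasing : ∀ i j → i Fin.< j → μ i ℤ.< μ j
    positive   : ∀ i → ∃ λ j → ∃ λ x → 0ℤ ℤ.< b i j x
    eigen      : ∀ i j x → sumℤ (λ y → edge x y ℤ.* b i j y) ≡ μ i ℤ.* b i j x
    orthogonal : ∀ i j k → sumℤ (λ x → w i j ℤ.* (b i j x ℤ.* b i k x)) ≡
                           (if does (j Fin.≟ k) then + norm else 0ℤ)
    complete   : ∀ x y → sumℤ (λ i → scaledP i x y) ≡
                         (if does (x Fin.≟ y) then + norm else 0ℤ)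

-- Finite sums, vectors and matrices over a commutative ring

module Sums (R : CommutativeRing 0ℓ 0ℓ) where
  open CommutativeRing R renaming (Carrier to A; refl to ≈-refl; zero to *-zero)
  open SemiringSum semiring public
    using (sum; *-distribˡ-sum; *-distribʳ-sum; ∑-comm; ∑-distrib-+; sum-cong-≋; sum-replicate-zero)
  open SetoidReasoning setoid
  open SemiringSolver commutativeSemiring using (solve; _:*_; _:=_)

  sum-zero : ∀ {n} (f : Vector A n) → (∀ i → f i ≈ 0#) → sum f ≈ 0#
  sum-zero {n} f f≈0 = trans (sum-cong-≋ f≈0) (sum-replicate-zero n)

  sum-single : ∀ {n} (f : Vector A n) i → (∀ k → k ≢ i → f k ≈ 0#) → sum f ≈ f i
  sum-single {suc n} f zero    f≈0 = begin
    f zero + sum (λ k → f (suc k)) ≈⟨ +-congˡ (sum-zero _ λ k → f≈0 (suc k) λ ()) ⟩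
    f zero + 0#                    ≈⟨ +-identityʳ (f zero) ⟩
    f zero                         ∎
  sum-single {suc n} f (suc i) f≈0 = begin
    f zero + sum (λ k → f (suc k)) ≈⟨ +-cong (f≈0 zero λ ()) (sum-single _ i λ k k≢i → f≈0 (suc k) λ { refl → k≢i refl }) ⟩
    0# + f (suc i)                 ≈⟨ +-identityˡ (f (suc i)) ⟩
    f (suc i)                      ∎

  δ : ∀ {n} → Fin n → Fin n → A
  δ x y = if does (x Fin.≟ y) then 1# else 0#

  sum-δ : ∀ {n} (f : Vector A n) x → sum (λ y → f y * δ x y) ≈ f x
  sum-δ f x = trans (sum-single _ x off-diagonal) diagonal
    where
    off-diagonal : ∀ y → y ≢ x → f y * δ x y ≈ 0#
    off-diagonal y y≢x with x Fin.≟ y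
    ... | yes x≡y = contradiction (≡.sym x≡y) y≢x
    ... | no  _   = zeroʳ (f y)
    diagonal : f x * δ x x ≈ f x
    diagonal with x Fin.≟ x
    ... | yes _   = *-identityʳ (f x)
    ... | no  x≢x = contradiction refl x≢x

  -- At the ring of reals these unfold to `⟨_,_⟩`, `_·_` and `combination`, so that results proved
  -- over `R` apply there without translation.
  inner : ∀ {n} → Vector A n → Vector A n → A
  inner v w = sum λ x → v x * w x

  apply : ∀ {n} → (Fin n → Fin n → A) → Vector A n → Vector A n
  apply M v x = sum λ y → M x y * v y

  linear : ∀ {n k} → Vector A k → (Fin k → Vector A n) → Vector A n
  linear c b x = sum λ j → c j * b j x

  apply-adjoint : ∀ {n} (M : Fin n → Fin n → A) → (∀ x y → M x y ≈ M y x) →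
                  ∀ u v → inner u (apply M v) ≈ inner (apply M u) v
  apply-adjoint M M-sym u v = begin
    sum (λ x → u x * apply M v x)                ≈⟨ sum-cong-≋ (λ x → *-distribˡ-sum (u x) (λ y → M x y * v y)) ⟩
    sum (λ x → sum λ y → u x * (M x y * v y))    ≈⟨ ∑-comm (λ x y → u x * (M x y * v y)) ⟩
    sum (λ y → sum λ x → u x * (M x y * v y))    ≈⟨ sum-cong-≋ (λ y → sum-cong-≋ λ x → swap x y) ⟩
    sum (λ y → sum λ x → (M y x * u x) * v y)    ≈⟨ sum-cong-≋ (λ y → *-distribʳ-sum (v y) (λ x → M y x * u x)) ⟨
    sum (λ y → apply M u y * v y)                ∎
    where
    swap : ∀ x y → u x * (M x y * v y) ≈ (M y x * u x) * v y
    swap x y = begin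
      u x * (M x y * v y)  ≈⟨ *-congˡ (*-congʳ (M-sym x y)) ⟩
      u x * (M y x * v y)  ≈⟨ solve 3 (λ u m v → u :* (m :* v) := (m :* u) :* v) ≈-refl (u x) (M y x) (v y) ⟩
      (M y x * u x) * v y  ∎

-- Eigenspaces and projections of an integral frame, by pure ring algebra

module _ {G : Graph} (F : IntegralFrame G) (R : CommutativeRing 0ℓ 0ℓ) where
  open Graph G
  open IntegralFrame F
  open CommutativeRing R renaming (Carrier to A; refl to ≈-refl; zero to *-zero)

  module FrameProjections
    (ι : ℤ → A)
    (ι-+ : ∀ m n → ι (m ℤ.+ n) ≈ ι m + ι n)
    (ι-* : ∀ m n → ι (m ℤ.* n) ≈ ι m * ι n)
    (ι-0 : ι 0ℤ ≈ 0#) (ι-1 : ι 1ℤ ≈ 1#)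
    (1/norm : A) (1/norm*norm : 1/norm * ι (+ norm) ≈ 1#)
    where

    open Sums R
    open SetoidReasoning setoid
    open SemiringSolver commutativeSemiring using (solve; _:*_; _:=_)
    open GroupProperties +-group using (identityˡ-unique)

    adjMatrix : V → V → A
    adjMatrix x y = if adj x y then 1# else 0#

    Eigen : A → Vector A order → Set
    Eigen ν v = ∀ x → apply adjMatrix v x ≈ ν * v x

    B : ∀ i → Fin (mult i) → Vector A order
    B i j x = ι (b i j x)

    P : Fin count → V → V → A
    P i x y = 1/norm * ι (scaledP i x y)

    -- The coordinate `⟨ b , v ⟩ / ⟨ b , b ⟩` for `b = B i j`, since `w i j` is `norm / ⟨ b , b ⟩`.
    coeff : ∀ i → Fin (mult i) → Vector A order → A
    coeff i j v = 1/norm * (ι (w i j) * inner (B i j) v)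

    ι-sum : ∀ {n} (f : Vector ℤ n) → ι (sumℤ f) ≈ sum (λ i → ι (f i))
    ι-sum {zero}  f = ι-0
    ι-sum {suc n} f = trans (ι-+ (f zero) (sumℤ λ i → f (suc i))) (+-congˡ (ι-sum λ i → f (suc i)))

    ι-triple : ∀ k m n → ι (k ℤ.* (m ℤ.* n)) ≈ ι k * (ι m * ι n)
    ι-triple k m n = trans (ι-* k (m ℤ.* n)) (*-congˡ (ι-* m n))

    scale-δ : ∀ {n} (x y : Fin n) → 1/norm * ι (if does (x Fin.≟ y) then + norm else 0ℤ) ≈ δ x y
    scale-δ x y with does (x Fin.≟ y)
    ... | true  = 1/norm*norm
    ... | false = trans (*-congˡ ι-0) (zeroʳ 1/norm)

    P-symmetric : ∀ i x y → P i x y ≈ P i y x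
    P-symmetric i x y = reflexive (cong (λ z → 1/norm * ι z)
      (sumℤ-cong λ j → cong (w i j ℤ.*_) (ℤ.*-comm (b i j x) (b i j y))))

    -- `P i` is the sum of the rank-one projections onto the basis vectors, and exchanging the two
    -- sums collects the coefficients. In this form, what is known of `B i` passes to the image of
    -- `P i`.
    P-combination : ∀ i v x → apply (P i) v x ≈ linear (λ j → coeff i j v) (B i) x
    P-combination i v x = begin
      sum (λ y → (1/norm * ι (scaledP i x y)) * v y)
        ≈⟨ sum-cong-≋ expand ⟩
      sum (λ y → sum λ j → c j * (B i j y * v y))
        ≈⟨ ∑-comm (λ y j → c j * (B i j y * v y)) ⟩
      sum (λ j → sum λ y → c j * (B i j y * v y))
        ≈⟨ sum-cong-≋ (λ j → *-distribˡ-sum (c j) (λ y → B i j y * v y)) ⟨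
      sum (λ j → c j * inner (B i j) v)
        ≈⟨ sum-cong-≋ (λ j → solve 4 (λ r w x s → ((r :* w) :* x) :* s := (r :* (w :* s)) :* x) ≈-refl
             1/norm (ι (w i j)) (B i j x) (inner (B i j) v)) ⟩
      sum (λ j → coeff i j v * B i j x) ∎
      where
      c : Fin (mult i) → A
      c j = (1/norm * ι (w i j)) * B i j x
      expand : ∀ y → (1/norm * ι (scaledP i x y)) * v y ≈ sum λ j → c j * (B i j y * v y)
      expand y = begin
        (1/norm * ι (scaledP i x y)) * v y
          ≈⟨ *-congʳ (*-congˡ (trans (ι-sum (λ j → w i j ℤ.* (b i j x ℤ.* b i j y)))
               (sum-cong-≋ λ j → ι-triple (w i j) (b i j x) (b i j y)))) ⟩
        (1/norm * sum s) * v y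
          ≈⟨ *-congʳ (*-distribˡ-sum 1/norm s) ⟩
        sum (λ j → 1/norm * s j) * v y
          ≈⟨ *-distribʳ-sum (v y) (λ j → 1/norm * s j) ⟩
        sum (λ j → (1/norm * s j) * v y)
          ≈⟨ sum-cong-≋ (λ j → solve 5 (λ r w x y v →
               (r :* (w :* (x :* y))) :* v := ((r :* w) :* x) :* (y :* v)) ≈-refl
               1/norm (ι (w i j)) (B i j x) (B i j y) (v y)) ⟩
        sum (λ j → c j * (B i j y * v y)) ∎
        where
        s : Fin (mult i) → A
        s j = ι (w i j) * (B i j x * B i j y)

    adjMatrix-symmetric : ∀ x y → adjMatrix x y ≈ adjMatrix y x
    adjMatrix-symmetric x y = reflexive (cong (λ e → if e then 1# else 0#) (symmetric x y))

    adjMatrix-ι : ∀ x y → adjMatrix x y ≈ ι (edge x y)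
    adjMatrix-ι x y with adj x y
    ... | true  = sym ι-1
    ... | false = sym ι-0

    B-eigen : ∀ i j → Eigen (ι (μ i)) (B i j)
    B-eigen i j x = begin
      sum (λ y → adjMatrix x y * B i j y)          ≈⟨ sum-cong-≋ (λ y → *-congʳ (adjMatrix-ι x y)) ⟩
      sum (λ y → ι (edge x y) * B i j y)           ≈⟨ sum-cong-≋ (λ y → ι-* (edge x y) (b i j y)) ⟨
      sum (λ y → ι (edge x y ℤ.* b i j y))         ≈⟨ ι-sum (λ y → edge x y ℤ.* b i j y) ⟨
      ι (sumℤ λ y → edge x y ℤ.* b i j y)          ≡⟨ cong ι (eigen i j x) ⟩
      ι (μ i ℤ.* b i j x)                          ≈⟨ ι-* (μ i) (b i j x) ⟩
      ι (μ i) * B i j x                            ∎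

    swap : ∀ x y z → x * (y * z) ≈ y * (x * z)
    swap = solve 3 (λ x y z → x :* (y :* z) := y :* (x :* z)) ≈-refl

    linear-eigen : ∀ i c → Eigen (ι (μ i)) (linear c (B i))
    linear-eigen i c x = begin
      sum (λ y → adjMatrix x y * linear c (B i) y)
        ≈⟨ sum-cong-≋ (λ y → *-distribˡ-sum (adjMatrix x y) (λ j → c j * B i j y)) ⟩
      sum (λ y → sum λ j → adjMatrix x y * (c j * B i j y))
        ≈⟨ ∑-comm (λ y j → adjMatrix x y * (c j * B i j y)) ⟩
      sum (λ j → sum λ y → adjMatrix x y * (c j * B i j y))
        ≈⟨ sum-cong-≋ (λ j → sum-cong-≋ λ y → swap (adjMatrix x y) (c j) (B i j y)) ⟩
      sum (λ j → sum λ y → c j * (adjMatrix x y * B i j y))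
        ≈⟨ sum-cong-≋ (λ j → *-distribˡ-sum (c j) (λ y → adjMatrix x y * B i j y)) ⟨
      sum (λ j → c j * apply adjMatrix (B i j) x)
        ≈⟨ sum-cong-≋ (λ j → *-congˡ (B-eigen i j x)) ⟩
      sum (λ j → c j * (ι (μ i) * B i j x))
        ≈⟨ sum-cong-≋ (λ j → swap (c j) (ι (μ i)) (B i j x)) ⟩
      sum (λ j → ι (μ i) * (c j * B i j x))
        ≈⟨ *-distribˡ-sum (ι (μ i)) (λ j → c j * B i j x) ⟨
      ι (μ i) * linear c (B i) x ∎

    -- ⟨ b , A v ⟩ = ⟨ A b , v ⟩ forces ν = μ i wherever v has a component along b i j.
    coeff-eigen : ∀ i j ν v → Eigen ν v → ν * coeff i j v ≈ ι (μ i) * coeff i j v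
    coeff-eigen i j ν v Av≈νv = begin
      ν * (1/norm * (ι (w i j) * s))        ≈⟨ pull ν s ⟩
      1/norm * (ι (w i j) * (ν * s))        ≈⟨ *-congˡ (*-congˡ νs≈μs) ⟩
      1/norm * (ι (w i j) * (ι (μ i) * s))  ≈⟨ pull (ι (μ i)) s ⟨
      ι (μ i) * (1/norm * (ι (w i j) * s))  ∎
      where
      s : A
      s = inner (B i j) v
      pull : ∀ x y → x * (1/norm * (ι (w i j) * y)) ≈ 1/norm * (ι (w i j) * (x * y))
      pull x y = solve 4 (λ r w x y → x :* (r :* (w :* y)) := r :* (w :* (x :* y))) ≈-refl 1/norm (ι (w i j)) x y
      νs≈μs : ν * s ≈ ι (μ i) * s
      νs≈μs = begin
        ν * s                                        ≈⟨ *-distribˡ-sum ν (λ x → B i j x * v x) ⟩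
        sum (λ x → ν * (B i j x * v x))              ≈⟨ sum-cong-≋ (λ x → swap ν (B i j x) (v x)) ⟩
        sum (λ x → B i j x * (ν * v x))              ≈⟨ sum-cong-≋ (λ x → *-congˡ (Av≈νv x)) ⟨
        inner (B i j) (apply adjMatrix v)            ≈⟨ apply-adjoint adjMatrix adjMatrix-symmetric (B i j) v ⟩
        inner (apply adjMatrix (B i j)) v            ≈⟨ sum-cong-≋ (λ x → *-congʳ (B-eigen i j x)) ⟩
        sum (λ x → (ι (μ i) * B i j x) * v x)        ≈⟨ sum-cong-≋ (λ x → *-assoc (ι (μ i)) (B i j x) (v x)) ⟩
        sum (λ x → ι (μ i) * (B i j x * v x))        ≈⟨ *-distribˡ-sum (ι (μ i)) (λ x → B i j x * v x) ⟨
        ι (μ i) * s                                  ∎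

    -- Serves twice: for ν one of the `μ k` it makes the other projections of an eigenvector vanish,
    -- and for arbitrary ν it identifies ν once some projection is apart from 0.
    P-eigen : ∀ i ν v → Eigen ν v → ∀ x → ν * apply (P i) v x ≈ ι (μ i) * apply (P i) v x
    P-eigen i ν v Av≈νv x = begin
      ν * apply (P i) v x                              ≈⟨ *-congˡ (P-combination i v x) ⟩
      ν * sum (λ j → coeff i j v * B i j x)            ≈⟨ *-distribˡ-sum ν (λ j → coeff i j v * B i j x) ⟩
      sum (λ j → ν * (coeff i j v * B i j x))          ≈⟨ sum-cong-≋ replace ⟩
      sum (λ j → ι (μ i) * (coeff i j v * B i j x))    ≈⟨ *-distribˡ-sum (ι (μ i)) (λ j → coeff i j v * B i j x) ⟨
      ι (μ i) * sum (λ j → coeff i j v * B i j x)      ≈⟨ *-congˡ (P-combination i v x) ⟨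
      ι (μ i) * apply (P i) v x                        ∎
      where
      replace : ∀ j → ν * (coeff i j v * B i j x) ≈ ι (μ i) * (coeff i j v * B i j x)
      replace j = trans (sym (*-assoc ν (coeff i j v) (B i j x)))
        (trans (*-congʳ (coeff-eigen i j ν v Av≈νv)) (*-assoc (ι (μ i)) (coeff i j v) (B i j x)))

    -- The resolution of the identity contained in `complete`, applied to `v`.
    sum-P : ∀ v x → v x ≈ sum λ i → apply (P i) v x
    sum-P v x = sym (begin
      sum (λ i → sum λ y → P i x y * v y)    ≈⟨ ∑-comm (λ i y → P i x y * v y) ⟩
      sum (λ y → sum λ i → P i x y * v y)    ≈⟨ sum-cong-≋ (λ y → *-distribʳ-sum (v y) (λ i → P i x y)) ⟨
      sum (λ y → sum (λ i → P i x y) * v y)  ≈⟨ sum-cong-≋ (λ y → *-congʳ (identity-matrix y)) ⟩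
      sum (λ y → δ x y * v y)                ≈⟨ sum-cong-≋ (λ y → *-comm (δ x y) (v y)) ⟩
      sum (λ y → v y * δ x y)                ≈⟨ sum-δ v x ⟩
      v x                                    ∎)
      where
      identity-matrix : ∀ y → sum (λ i → P i x y) ≈ δ x y
      identity-matrix y = begin
        sum (λ i → 1/norm * ι (scaledP i x y))   ≈⟨ *-distribˡ-sum 1/norm (λ i → ι (scaledP i x y)) ⟨
        1/norm * sum (λ i → ι (scaledP i x y))   ≈⟨ *-congˡ (ι-sum (λ i → scaledP i x y)) ⟨
        1/norm * ι (sumℤ λ i → scaledP i x y)    ≡⟨ cong (λ z → 1/norm * ι z) (complete x y) ⟩
        1/norm * ι (if does (x Fin.≟ y) then + norm else 0ℤ) ≈⟨ scale-δ x y ⟩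
        δ x y                                    ∎

    -- Orthogonality of the frame lets `coeff` read off the coordinates of a combination, which
    -- yields linear independence.
    coeff-linear : ∀ i c k → coeff i k (linear c (B i)) ≈ c k
    coeff-linear i c k = begin
      1/norm * (ι (w i k) * sum (λ x → B i k x * sum (λ j → c j * B i j x)))
        ≈⟨ *-assoc _ _ _ ⟨
      rw * sum (λ x → B i k x * sum (λ j → c j * B i j x))
        ≈⟨ *-congˡ (sum-cong-≋ λ x → *-distribˡ-sum (B i k x) (λ j → c j * B i j x)) ⟩
      rw * sum (λ x → sum λ j → B i k x * (c j * B i j x))
        ≈⟨ *-congˡ (∑-comm λ x j → B i k x * (c j * B i j x)) ⟩
      rw * sum (λ j → sum λ x → B i k x * (c j * B i j x))
        ≈⟨ *-distribˡ-sum rw (λ j → sum λ x → B i k x * (c j * B i j x)) ⟩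
      sum (λ j → rw * sum λ x → B i k x * (c j * B i j x))
        ≈⟨ sum-cong-≋ entry ⟩
      sum (λ j → c j * δ k j)
        ≈⟨ sum-δ c k ⟩
      c k ∎
      where
      rw : A
      rw = 1/norm * ι (w i k)
      entry : ∀ j → rw * sum (λ x → B i k x * (c j * B i j x)) ≈ c j * δ k j
      entry j = begin
        rw * sum (λ x → B i k x * (c j * B i j x))
          ≈⟨ *-distribˡ-sum rw (λ x → B i k x * (c j * B i j x)) ⟩
        sum (λ x → rw * (B i k x * (c j * B i j x)))
          ≈⟨ sum-cong-≋ (λ x → solve 5 (λ r w a c b →
               (r :* w) :* (a :* (c :* b)) := (c :* r) :* (w :* (a :* b))) ≈-refl
               1/norm (ι (w i k)) (B i k x) (c j) (B i j x)) ⟩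
        sum (λ x → (c j * 1/norm) * (ι (w i k) * (B i k x * B i j x)))
          ≈⟨ *-distribˡ-sum (c j * 1/norm) (λ x → ι (w i k) * (B i k x * B i j x)) ⟨
        (c j * 1/norm) * sum (λ x → ι (w i k) * (B i k x * B i j x))
          ≈⟨ *-congˡ (trans (ι-sum λ x → w i k ℤ.* (b i k x ℤ.* b i j x))
               (sum-cong-≋ λ x → ι-triple (w i k) (b i k x) (b i j x))) ⟨
        (c j * 1/norm) * ι (sumℤ λ x → w i k ℤ.* (b i k x ℤ.* b i j x))
          ≡⟨ cong (λ z → (c j * 1/norm) * ι z) (orthogonal i k j) ⟩
        (c j * 1/norm) * ι (if does (k Fin.≟ j) then + norm else 0ℤ)
          ≈⟨ *-assoc (c j) 1/norm _ ⟩
        c j * (1/norm * ι (if does (k Fin.≟ j) then + norm else 0ℤ))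
          ≈⟨ *-congˡ (scale-δ k j) ⟩
        c j * δ k j ∎

    coeff-zero : ∀ i k v → (∀ x → v x ≈ 0#) → coeff i k v ≈ 0#
    coeff-zero i k v v≈0 = begin
      1/norm * (ι (w i k) * inner (B i k) v)  ≈⟨ *-congˡ (*-congˡ (sum-zero _ λ x →
                                                   trans (*-congˡ (v≈0 x)) (zeroʳ (B i k x)))) ⟩
      1/norm * (ι (w i k) * 0#)               ≈⟨ *-congˡ (zeroʳ (ι (w i k))) ⟩
      1/norm * 0#                             ≈⟨ zeroʳ 1/norm ⟩
      0#                                      ∎

    B-independent : ∀ i c → (∀ x → linear c (B i) x ≈ 0#) → ∀ k → c k ≈ 0#
    B-independent i c c≈0 k = trans (sym (coeff-linear i c k)) (coeff-zero i k (linear c (B i)) c≈0)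

    P-image : ∀ i v → Eigen (ι (μ i)) (apply (P i) v)
    P-image i v x = begin
      apply adjMatrix (apply (P i) v) x
        ≈⟨ sum-cong-≋ (λ y → *-congˡ (P-combination i v y)) ⟩
      apply adjMatrix (linear (λ j → coeff i j v) (B i)) x
        ≈⟨ linear-eigen i (λ j → coeff i j v) x ⟩
      ι (μ i) * linear (λ j → coeff i j v) (B i) x
        ≈⟨ *-congˡ (P-combination i v x) ⟨
      ι (μ i) * apply (P i) v x ∎

    module _ (separated : ∀ i k → k ≢ i → ∀ x → ι (μ i) * x ≈ ι (μ k) * x → x ≈ 0#) where

      -- For k ≠ i, `P-eigen` says that `μ i` and `μ k` act alike on `apply (P k) v`, so `separated`
      -- makes it zero. Only the term of `i` is left in `sum-P`. The hypothesis `separated` stands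
      -- in for cancellation, which a general ring lacks.
      P-fixes : ∀ i v → Eigen (ι (μ i)) v → ∀ x → v x ≈ apply (P i) v x
      P-fixes i v Av≈μv x = trans (sum-P v x) (sum-single (λ k → apply (P k) v x) i λ k k≢i →
        separated i k k≢i (apply (P k) v x) (P-eigen k (ι (μ i)) v Av≈μv x))

      B-spanning : ∀ i v → Eigen (ι (μ i)) v → ∀ x → v x ≈ linear (λ j → coeff i j v) (B i) x
      B-spanning i v Av≈μv x = trans (P-fixes i v Av≈μv x) (P-combination i v x)

      -- As `P i` is symmetric and fixes `w`, the vectors `v` and `Pv` have the same inner product
      -- with `w`. Hence adding the residual term to `inner Pv w` changes nothing, and that term is
      -- 0.
      P-residual : ∀ i v w → Eigen (ι (μ i)) w → inner (λ x → v x + (- apply (P i) v x)) w ≈ 0#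
      P-residual i v w Aw≈μw = identityˡ-unique _ (inner Pv w) (begin
        inner (λ x → v x + (- Pv x)) w + inner Pv w
          ≈⟨ ∑-distrib-+ (λ x → (v x + (- Pv x)) * w x) (λ x → Pv x * w x) ⟨
        sum (λ x → (v x + (- Pv x)) * w x + Pv x * w x)
          ≈⟨ sum-cong-≋ recombine ⟩
        inner v w
          ≈⟨ sum-cong-≋ (λ x → *-congˡ (P-fixes i w Aw≈μw x)) ⟩
        inner v (apply (P i) w)
          ≈⟨ apply-adjoint (P i) (P-symmetric i) v w ⟩
        inner Pv w ∎)
        where
        Pv : Vector A order
        Pv = apply (P i) v
        recombine : ∀ x → (v x + (- Pv x)) * w x + Pv x * w x ≈ v x * w x
        recombine x = begin
          (v x + (- Pv x)) * w x + Pv x * w x  ≈⟨ distribʳ (w x) (v x + (- Pv x)) (Pv x) ⟨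
          ((v x + (- Pv x)) + Pv x) * w x      ≈⟨ *-congʳ (+-assoc (v x) (- Pv x) (Pv x)) ⟩
          (v x + ((- Pv x) + Pv x)) * w x      ≈⟨ *-congʳ (+-congˡ (-‿inverseˡ (Pv x))) ⟩
          (v x + 0#) * w x                     ≈⟨ *-congʳ (+-identityʳ (v x)) ⟩
          v x * w x                            ∎

-- Real numbers

open import Defs

open +-*-Solver using (solve; _:+_; _:-_; _:*_; :-_; _:=_)

-- As _≈_ unfolds to a function type, its arguments cannot be inferred from a
-- proof; the ring of reals is therefore set up with a record-wrapped equality.
infix 4 _≃_

record _≃_ (x y : ℝ) : Set where
  constructor ⟪_⟫
  field
    unwrap : x ≈ y

open _≃_ public

-- The ring laws hold term by term and come from ℚ in this way; only symmetry, transitivity and the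
-- congruences call for estimates.
pointwise : ∀ {x y} → (∀ n → seq x n ≡ seq y n) → x ≃ y
pointwise {x} {y} eq = ⟪ (λ ε ε>0 → 0 , λ n _ →
  subst (λ d → ∣ d ∣ ℚ.< ε)
    (≡.sym (≡.trans (cong (ℚ._- seq y n) (eq n)) (ℚ.+-inverseʳ (seq y n)))) ε>0) ⟫

∣p-q∣≡∣q-p∣ : ∀ p q → ∣ p ℚ.- q ∣ ≡ ∣ q ℚ.- p ∣
∣p-q∣≡∣q-p∣ p q = ≡.trans (≡.sym (ℚ.∣-p∣≡∣p∣ (p ℚ.- q)))
  (cong ∣_∣ (solve 2 (λ p q → :- (p :- q) := q :- p) refl p q))

≈-sym : ∀ {x y} → x ≈ y → y ≈ x
≈-sym {x} {y} p ε ε>0 with p ε ε>0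
... | N , q = N , λ n N≤n → subst (ℚ._< ε) (∣p-q∣≡∣q-p∣ (seq x n) (seq y n)) (q n N≤n)

triangle : ∀ a b c {η θ} → ∣ a ℚ.- b ∣ ℚ.< η → ∣ b ℚ.- c ∣ ℚ.< θ → ∣ a ℚ.- c ∣ ℚ.< η ℚ.+ θ
triangle a b c {η} {θ} p q = begin-strict
  ∣ a ℚ.- c ∣                  ≡⟨ cong ∣_∣ (solve 3 (λ a b c → a :- c := (a :- b) :+ (b :- c)) refl a b c) ⟩
  ∣ (a ℚ.- b) ℚ.+ (b ℚ.- c) ∣  ≤⟨ ℚ.∣p+q∣≤∣p∣+∣q∣ (a ℚ.- b) (b ℚ.- c) ⟩
  ∣ a ℚ.- b ∣ ℚ.+ ∣ b ℚ.- c ∣  <⟨ ℚ.+-mono-< p q ⟩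
  η ℚ.+ θ                      ∎
  where open ℚ.≤-Reasoning

≈-trans : ∀ {x y z} → x ≈ y → y ≈ z → x ≈ z
≈-trans {x} {y} {z} p q ε ε>0 with p (½ ℚ.* ε) (half-pos ε>0) | q (½ ℚ.* ε) (half-pos ε>0)
... | M , p′ | N , q′ = M ℕ.⊔ N , λ n le → subst (_ ℚ.<_) (half+half ε)
  (triangle (seq x n) (seq y n) (seq z n)
    (p′ n (ℕ.m⊔n≤o⇒m≤o M N le)) (q′ n (ℕ.m⊔n≤o⇒n≤o M N le)))

+-cong : ∀ {x x′ y y′} → x ≈ x′ → y ≈ y′ → x + y ≈ x′ + y′
+-cong {x} {x′} {y} {y′} p q ε ε>0 with p (½ ℚ.* ε) (half-pos ε>0) | q (½ ℚ.* ε) (half-pos ε>0)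
... | M , p′ | N , q′ = M ℕ.⊔ N , λ n le → subst (_ ℚ.<_) (half+half ε)
  (+-close (seq x n) (seq y n) (seq x′ n) (seq y′ n)
    (p′ n (ℕ.m⊔n≤o⇒m≤o M N le)) (q′ n (ℕ.m⊔n≤o⇒n≤o M N le)))

-‿cong : ∀ {x y} → x ≈ y → - x ≈ - y
-‿cong {x} {y} p ε ε>0 with p ε ε>0
... | N , q = N , λ n le → subst (ℚ._< ε) (≡.sym (neg-close (seq x n) (seq y n))) (q n le)

*-cong : ∀ {x x′ y y′} → x ≈ x′ → y ≈ y′ → x * y ≈ x′ * y′
-- The two factors to bound are the outer ones in x(y - y′) + y′(x - x′), the form given by
-- `*-regroup`.
*-cong {x} {x′} {y} {y′} p q ε ε>0 = combine (bounded x) (bounded y′)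
  where
  combine : (∃ λ B → 0ℚ ℚ.< B × ∃ λ N → ∀ n → N ℕ.≤ n → ∣ seq x n ∣ ℚ.≤ B) →
            (∃ λ C → 0ℚ ℚ.< C × ∃ λ N → ∀ n → N ℕ.≤ n → ∣ seq y′ n ∣ ℚ.≤ C) →
            ∃ λ N → ∀ n → N ℕ.≤ n → ∣ seq x n ℚ.* seq y n ℚ.- seq x′ n ℚ.* seq y′ n ∣ ℚ.< ε
  combine (B , B>0 , M₁ , b) (C , C>0 , M₂ , c) =
    finish (quotient B B>0 (½ ℚ.* ε) (half-pos ε>0)) (quotient C C>0 (½ ℚ.* ε) (half-pos ε>0))
    where
    finish : (∃ λ δ → 0ℚ ℚ.< δ × B ℚ.* δ ≡ ½ ℚ.* ε) →
             (∃ λ θ → 0ℚ ℚ.< θ × C ℚ.* θ ≡ ½ ℚ.* ε) →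
             ∃ λ N → ∀ n → N ℕ.≤ n → ∣ seq x n ℚ.* seq y n ℚ.- seq x′ n ℚ.* seq y′ n ∣ ℚ.< ε
    finish (δ , δ>0 , Bδ) (θ , θ>0 , Cθ) = M ℕ.⊔ N , λ n le →
      let M≤n = ℕ.m⊔n≤o⇒m≤o M N le
          N≤n = ℕ.m⊔n≤o⇒n≤o M N le
      in subst (∣ seq x n ℚ.* seq y n ℚ.- seq x′ n ℚ.* seq y′ n ∣ ℚ.<_) (≡.trans (cong₂ ℚ._+_ Bδ Cθ) (half+half ε))
        (*-close (seq x n) (seq y n) (seq x′ n) (seq y′ n) B>0 C>0
          (b n (ℕ.m⊔n≤o⇒m≤o M₁ M₂ M≤n)) (c n (ℕ.m⊔n≤o⇒n≤o M₁ M₂ M≤n))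
          (q δ δ>0 .proj₂ n (ℕ.m⊔n≤o⇒m≤o N₁ N₂ N≤n)) (p θ θ>0 .proj₂ n (ℕ.m⊔n≤o⇒n≤o N₁ N₂ N≤n)))
      where
      M N₁ N₂ N : ℕ
      M  = M₁ ℕ.⊔ M₂
      N₁ = q δ δ>0 .proj₁
      N₂ = p θ θ>0 .proj₁
      N  = N₁ ℕ.⊔ N₂

ℝ-commutativeRing : CommutativeRing 0ℓ 0ℓ
ℝ-commutativeRing = record
  { Carrier = ℝ ; _≈_ = _≃_ ; _+_ = _+_ ; _*_ = _*_ ; -_ = -_ ; 0# = 0ℝ ; 1# = 1ℝ
  ; isCommutativeRing = record
    { isRing = record
      { +-isAbelianGroup = record
        { isGroup = record
          { isMonoid = record
            { isSemigroup = record
              { isMagma = record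
                { isEquivalence = record
                  { refl  = pointwise λ _ → refl
                  ; sym   = λ {x y} p → ⟪ ≈-sym {x} {y} (p .unwrap) ⟫
                  ; trans = λ {x y z} p q → ⟪ ≈-trans {x} {y} {z} (p .unwrap) (q .unwrap) ⟫ }
                ; ∙-cong = λ {x x′ y y′} p q → ⟪ +-cong {x} {x′} {y} {y′} (p .unwrap) (q .unwrap) ⟫ }
              ; assoc = λ x y z → pointwise λ n → ℚ.+-assoc (seq x n) (seq y n) (seq z n) }
            ; identity = (λ x → pointwise λ n → ℚ.+-identityˡ (seq x n))
                       , (λ x → pointwise λ n → ℚ.+-identityʳ (seq x n)) }
          ; inverse = (λ x → pointwise λ n → ℚ.+-inverseˡ (seq x n))
                    , (λ x → pointwise λ n → ℚ.+-inverseʳ (seq x n))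
          ; ⁻¹-cong = λ {x y} p → ⟪ -‿cong {x} {y} (p .unwrap) ⟫ }
        ; comm = λ x y → pointwise λ n → ℚ.+-comm (seq x n) (seq y n) }
      ; *-cong = λ {x x′ y y′} p q → ⟪ *-cong {x} {x′} {y} {y′} (p .unwrap) (q .unwrap) ⟫
      ; *-assoc = λ x y z → pointwise λ n → ℚ.*-assoc (seq x n) (seq y n) (seq z n)
      ; *-identity = (λ x → pointwise λ n → ℚ.*-identityˡ (seq x n))
                   , (λ x → pointwise λ n → ℚ.*-identityʳ (seq x n))
      ; distrib = (λ x y z → pointwise λ n → ℚ.*-distribˡ-+ (seq x n) (seq y n) (seq z n))
                , (λ x y z → pointwise λ n → ℚ.*-distribʳ-+ (seq x n) (seq y n) (seq z n)) }
    ; *-comm = λ x y → pointwise λ n → ℚ.*-comm (seq x n) (seq y n) } }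

-- Reals bounded away from zero

p≤∣p∣ : ∀ p → p ℚ.≤ ∣ p ∣
p≤∣p∣ p with ℚ.≤-total 0ℚ p
... | inj₁ 0≤p = ℚ.≤-reflexive (≡.sym (ℚ.0≤p⇒∣p∣≡p 0≤p))
... | inj₂ p≤0 = ℚ.≤-trans p≤0 (ℚ.0≤∣p∣ p)

-- Apartness from 0 without the choice of a sign that `_#_` carries; absolute values then suffice
-- for sums and products.
Nonzero : ℝ → Set
Nonzero x = ∃ λ ε → 0ℚ ℚ.< ε × ∃ λ N → ∀ n → N ℕ.≤ n → ε ℚ.< ∣ seq x n ∣

#⇒nonzero : ∀ x y → x # y → Nonzero (x - y)
#⇒nonzero x y (inj₁ (ε , ε>0 , N , p)) = ε , ε>0 , N , λ n le →
  ℚ.<-≤-trans (p n le) (ℚ.≤-trans (p≤∣p∣ (seq y n ℚ.- seq x n))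
    (ℚ.≤-reflexive (∣p-q∣≡∣q-p∣ (seq y n) (seq x n))))
#⇒nonzero x y (inj₂ (ε , ε>0 , N , p)) = ε , ε>0 , N , λ n le →
  ℚ.<-≤-trans (p n le) (p≤∣p∣ (seq x n ℚ.- seq y n))

∣p∣-∣p-q∣≤∣q∣ : ∀ p q → ∣ p ∣ ℚ.- ∣ p ℚ.- q ∣ ℚ.≤ ∣ q ∣
∣p∣-∣p-q∣≤∣q∣ p q = begin
  ∣ p ∣ ℚ.- d                    ≡⟨ cong (λ z → ∣ z ∣ ℚ.- d) (solve 2 (λ p q → p := q :+ (p :- q)) refl p q) ⟩
  ∣ q ℚ.+ (p ℚ.- q) ∣ ℚ.- d      ≤⟨ ℚ.+-monoˡ-≤ (ℚ.- d) (ℚ.∣p+q∣≤∣p∣+∣q∣ q (p ℚ.- q)) ⟩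
  (∣ q ∣ ℚ.+ d) ℚ.- d            ≡⟨ solve 2 (λ q d → (q :+ d) :- d := q) refl ∣ q ∣ d ⟩
  ∣ q ∣                          ∎
  where
  open ℚ.≤-Reasoning
  d : ℚ
  d = ∣ p ℚ.- q ∣

<-minus : ∀ {p q r s} → p ℚ.+ r ℚ.≤ q → s ℚ.< r → p ℚ.< q ℚ.- s
<-minus {p} {q} {r} {s} p+r≤q s<r = begin-strict
  p                  ≡⟨ solve 2 (λ p s → p := (p :+ s) :- s) refl p s ⟩
  (p ℚ.+ s) ℚ.- s    <⟨ ℚ.+-monoˡ-< (ℚ.- s) (ℚ.+-monoʳ-< p s<r) ⟩
  (p ℚ.+ r) ℚ.- s    ≤⟨ ℚ.+-monoˡ-≤ (ℚ.- s) p+r≤q ⟩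
  q ℚ.- s            ∎
  where open ℚ.≤-Reasoning

nonzero-resp-≃ : ∀ {x y} → x ≃ y → Nonzero x → Nonzero y
nonzero-resp-≃ {x} {y} ⟪ x≈y ⟫ (ε , ε>0 , N , p) with x≈y (½ ℚ.* ε) (half-pos ε>0)
... | M , q = ½ ℚ.* ε , half-pos ε>0 , N ℕ.⊔ M , λ n le →
  ℚ.<-≤-trans (<-minus (ℚ.≤-trans (ℚ.≤-reflexive (half+half ε)) (ℚ.<⇒≤ (p n (ℕ.m⊔n≤o⇒m≤o N M le))))
                       (q n (ℕ.m⊔n≤o⇒n≤o N M le)))
              (∣p∣-∣p-q∣≤∣q∣ (seq x n) (seq y n))

-- With x known to within ε/4, compare one late term of x with ε/2: either it
-- keeps x away from 0, or it bounds x by 3ε/4 and leaves ε/4 for y.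
+-nonzero : ∀ x y → Nonzero (x + y) → Nonzero x ⊎ Nonzero y
+-nonzero x y (ε , ε>0 , N , p) = decide (½ε ℚ.≤? ∣ seq x K ∣)
  where
  ½ε ¼ε : ℚ
  ½ε = ½ ℚ.* ε
  ¼ε = ½ ℚ.* ½ε
  ½ε>0 : 0ℚ ℚ.< ½ε
  ½ε>0 = half-pos ε>0
  ¼ε>0 : 0ℚ ℚ.< ¼ε
  ¼ε>0 = half-pos ½ε>0
  M K : ℕ
  M = cauchy x ¼ε ¼ε>0 .proj₁
  K = N ℕ.⊔ M
  close : ∀ m n → K ℕ.≤ m → K ℕ.≤ n → ∣ seq x m ℚ.- seq x n ∣ ℚ.< ¼ε
  close m n K≤m K≤n = cauchy x ¼ε ¼ε>0 .proj₂ m n (ℕ.m⊔n≤o⇒n≤o N M K≤m) (ℕ.m⊔n≤o⇒n≤o N M K≤n)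
  open ℚ.≤-Reasoning

  small : ∣ seq x K ∣ ℚ.< ½ε → ∀ n → K ℕ.≤ n → ∣ seq x n ∣ ℚ.< ½ε ℚ.+ ¼ε
  small lt n K≤n = begin-strict
    ∣ seq x n ∣                                      ≡⟨ cong ∣_∣ (cancel (seq x n) (seq x K)) ⟩
    ∣ (seq x n ℚ.- seq x K) ℚ.+ seq x K ∣            ≤⟨ ℚ.∣p+q∣≤∣p∣+∣q∣ (seq x n ℚ.- seq x K) (seq x K) ⟩
    ∣ seq x n ℚ.- seq x K ∣ ℚ.+ ∣ seq x K ∣          <⟨ ℚ.+-mono-< (close n K K≤n ℕ.≤-refl) lt ⟩
    ¼ε ℚ.+ ½ε                                        ≡⟨ ℚ.+-comm ¼ε ½ε ⟩
    ½ε ℚ.+ ¼ε                                        ∎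

  decide : _ → Nonzero x ⊎ Nonzero y
  decide (yes ½ε≤x) = inj₁ (¼ε , ¼ε>0 , K , λ n K≤n →
    ℚ.<-≤-trans (<-minus (ℚ.≤-trans (ℚ.≤-reflexive (half+half ½ε)) ½ε≤x) (close K n ℕ.≤-refl K≤n))
                (∣p∣-∣p-q∣≤∣q∣ (seq x K) (seq x n)))
  decide (no ½ε≰x) = inj₂ (¼ε , ¼ε>0 , K , λ n K≤n → begin-strict
    ¼ε
      <⟨ <-minus (ℚ.≤-reflexive quarters) (small (ℚ.≰⇒> ½ε≰x) n K≤n) ⟩
    ε ℚ.- ∣ seq x n ∣
      ≤⟨ ℚ.+-monoˡ-≤ (ℚ.- ∣ seq x n ∣) (ℚ.<⇒≤ (p n (ℕ.m⊔n≤o⇒m≤o N M K≤n))) ⟩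
    ∣ s n ∣ ℚ.- ∣ seq x n ∣
      ≡⟨ cong (λ z → ∣ s n ∣ ℚ.- ∣ z ∣) (solve 2 (λ a b → a := (a :+ b) :- b) refl (seq x n) (seq y n)) ⟩
    ∣ s n ∣ ℚ.- ∣ s n ℚ.- seq y n ∣
      ≤⟨ ∣p∣-∣p-q∣≤∣q∣ (s n) (seq y n) ⟩
    ∣ seq y n ∣ ∎)
    where
    s : ℕ → ℚ
    s n = seq x n ℚ.+ seq y n
    quarters : ¼ε ℚ.+ (½ε ℚ.+ ¼ε) ≡ ε
    quarters = ≡.trans (solve 2 (λ a b → a :+ (b :+ a) := (a :+ a) :+ b) refl ¼ε ½ε)
      (≡.trans (cong (ℚ._+ ½ε) (half+half ½ε)) (half+half ε))

0-not-nonzero : ¬ Nonzero 0ℝ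
0-not-nonzero (ε , ε>0 , N , p) = ℚ.<-asym ε>0 (p N ℕ.≤-refl)

-- Equality of reals is not decidable, so the summand cannot be found by testing; `+-nonzero`
-- chooses a side at each stage.
sum-nonzero : ∀ {n} (f : Fin n → ℝ) → Nonzero (sum f) → ∃ λ i → Nonzero (f i)
sum-nonzero {zero}  f p = contradiction p 0-not-nonzero
sum-nonzero {suc n} f p with +-nonzero (f zero) (sum (λ i → f (suc i))) p
... | inj₁ q = zero , q
... | inj₂ q with sum-nonzero (λ i → f (suc i)) q
... | i , r = suc i , r

-- Late enough `∣ y ∣` exceeds `η`, so `∣ x ∣ ≥ ε` would force `∣ x * y ∣ ≥ ε * η`. The product is
-- therefore taken to within `ε * η`.
*-cancel-nonzero : ∀ x y → Nonzero y → x * y ≃ 0ℝ → x ≃ 0ℝ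
*-cancel-nonzero x y (η , η>0 , M , p) ⟪ xy≈0 ⟫ = ⟪ x≈0 ⟫
  where
  open ℚ.≤-Reasoning
  x≈0 : x ≈ 0ℝ
  x≈0 ε ε>0 with xy≈0 (ε ℚ.* η) (ℚ.positive⁻¹ (ε ℚ.* η) {{ℚ.pos*pos⇒pos ε {{ℚ.positive ε>0}} η {{ℚ.positive η>0}}}})
  ... | N , q = M ℕ.⊔ N , λ n le → subst (λ z → ∣ z ∣ ℚ.< ε) (≡.sym (ℚ.+-identityʳ (seq x n)))
    (ℚ.≰⇒> λ ε≤x → ℚ.<-irrefl refl (begin-strict
      ε ℚ.* η                     ≤⟨ ℚ.*-monoʳ-≤-nonNeg η {{ℚ.pos⇒nonNeg η {{ℚ.positive η>0}}}} ε≤x ⟩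
      ∣ seq x n ∣ ℚ.* η           ≤⟨ ℚ.*-monoˡ-≤-nonNeg ∣ seq x n ∣ {{ℚ.∣-∣-nonNeg (seq x n)}} (ℚ.<⇒≤ (p n (ℕ.m⊔n≤o⇒m≤o M N le))) ⟩
      ∣ seq x n ∣ ℚ.* ∣ seq y n ∣ ≡⟨ ℚ.∣p*q∣≡∣p∣*∣q∣ (seq x n) (seq y n) ⟨
      ∣ seq x n ℚ.* seq y n ∣     ≡⟨ cong ∣_∣ (ℚ.+-identityʳ (seq x n ℚ.* seq y n)) ⟨
      ∣ seq x n ℚ.* seq y n ℚ.- 0ℚ ∣ <⟨ q n (ℕ.m⊔n≤o⇒n≤o M N le) ⟩
      ε ℚ.* η                     ∎))

-- Rationals and integers inside the reals

fromℚ-injective : ∀ {p q} → fromℚ p ≈ fromℚ q → p ≡ q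
fromℚ-injective {p} {q} p≈q with ∣ p ℚ.- q ∣ ℚ.≤? 0ℚ
... | yes le = difference-zero (ℚ.∣p∣≡0⇒p≡0 (p ℚ.- q) (ℚ.≤-antisym le (ℚ.0≤∣p∣ (p ℚ.- q))))
  where
  difference-zero : p ℚ.- q ≡ 0ℚ → p ≡ q
  difference-zero eq = ≡.trans (cancel p q) (≡.trans (cong (ℚ._+ q) eq) (ℚ.+-identityˡ q))
... | no ≰ with p≈q ∣ p ℚ.- q ∣ (ℚ.≰⇒> ≰)
... | N , lt = contradiction (lt N ℕ.≤-refl) (ℚ.<-irrefl refl)

-- With denominator 1 written out, the numerator gives the integer back by computation, and 0 and 1
-- become `0ℚ` and `1ℚ` definitionally.
integer : ℤ → ℚ
integer z = mkℚ z 0 (Coprimality.sym (Coprimality.1-coprimeTo _))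

integer-+ : ∀ a b → integer (a ℤ.+ b) ≡ integer a ℚ.+ integer b
integer-+ a b = ℚ.toℚᵘ-injective (ℚᵘ.≃-trans
  (ℚᵘ.*≡* (cong (ℤ._* + 1) (cong₂ ℤ._+_ (≡.sym (ℤ.*-identityʳ a)) (≡.sym (ℤ.*-identityʳ b)))))
  (ℚᵘ.≃-sym (ℚ.toℚᵘ-homo-+ (integer a) (integer b))))

integer-* : ∀ a b → integer (a ℤ.* b) ≡ integer a ℚ.* integer b
integer-* a b = ℚ.toℚᵘ-injective (ℚᵘ.≃-sym (ℚ.toℚᵘ-homo-* (integer a) (integer b)))

ι : ℤ → ℝ
ι z = fromℚ (integer z)

ι-+ : ∀ a b → ι (a ℤ.+ b) ≃ ι a + ι b
ι-+ a b = pointwise λ _ → integer-+ a b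

ι-* : ∀ a b → ι (a ℤ.* b) ≃ ι a * ι b
ι-* a b = pointwise λ _ → integer-* a b

ι-injective : ∀ {a b} → ι a ≈ ι b → a ≡ b
ι-injective {a} {b} eq = cong ℚ.ℚ.numerator (fromℚ-injective {integer a} {integer b} eq)

ι-mono-< : ∀ {a b} → a ℤ.< b → ι a < ι b
-- The order on ℝ asks for a gap strictly smaller than the constant difference; density of ℚ
-- supplies one.
ι-mono-< {a} {b} a<b with ℚ.<-dense (subst (ℚ._< integer b ℚ.- integer a) (ℚ.+-inverseʳ (integer a)) (ℚ.+-monoˡ-< (ℚ.- integer a) a<b′))
  where
  a<b′ : integer a ℚ.< integer b
  a<b′ = ℚ.*<* (ℤ.*-monoʳ-<-pos (+ 1) a<b)
... | ε , ε>0 , ε<b-a = ε , ε>0 , 0 , λ _ _ → ε<b-a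

module ℜ = CommutativeRing ℝ-commutativeRing

difference-* : ∀ {x y z} → x * z ≃ y * z → (x - y) * z ≃ 0ℝ
difference-* {x} {y} {z} xz≃yz = ℜ.trans
  (pointwise λ n → solve 3 (λ x y z → (x :- y) :* z := (x :* z) :- (y :* z)) refl (seq x n) (seq y n) (seq z n))
  (ℜ.trans (ℜ.+-congʳ xz≃yz) (ℜ.-‿inverseʳ (y * z)))

#-separates : ∀ {x y} → x # y → ∀ z → x * z ≃ y * z → z ≃ 0ℝ
#-separates {x} {y} x#y z xz≃yz = *-cancel-nonzero z (x - y) (#⇒nonzero x y x#y)
  (ℜ.trans (ℜ.*-comm z (x - y)) (difference-* xz≃yz))

*-cancelʳ-nonzero : ∀ x y z → Nonzero z → x * z ≃ y * z → x ≃ y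
*-cancelʳ-nonzero x y z z≠0 xz≃yz = GroupProperties.x∙y⁻¹≈ε⇒x≈y ℜ.+-group x y
  (*-cancel-nonzero (x - y) z z≠0 (difference-* xz≃yz))

1/ℚ : ∀ n → {{ℕ.NonZero n}} → ℚ
1/ℚ n {{n≢0}} = ℚ.1/_ (integer (+ n)) {{n≢0}}

1/ℝ : ∀ n → {{ℕ.NonZero n}} → ℝ
1/ℝ n = fromℚ (1/ℚ n)

1/ℝ-inverse : ∀ n → {{_ : ℕ.NonZero n}} → 1/ℝ n * ι (+ n) ≃ 1ℝ
1/ℝ-inverse n {{n≢0}} = pointwise λ _ → ℚ.*-inverseˡ (integer (+ n)) {{n≢0}}

-- Turns an equation between real entries of projections into one between integers, which can be
-- decided.
1/ℝ-injective : ∀ n → {{_ : ℕ.NonZero n}} → ∀ {a b} → 1/ℝ n * ι a ≈ 1/ℝ n * ι b → a ≡ b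
1/ℝ-injective n {a} {b} eq = ι-injective (≃-chain .unwrap)
  where
  clear : ∀ z → ι (+ n) * (1/ℝ n * ι z) ≃ ι z
  clear z = ℜ.trans (pointwise λ _ → solve 3 (λ m r z → m :* (r :* z) := (r :* m) :* z) refl
              (integer (+ n)) (1/ℚ n) (integer z))
            (ℜ.trans (ℜ.*-congʳ (1/ℝ-inverse n)) (ℜ.*-identityˡ (ι z)))
  ≃-chain : ι a ≃ ι b
  ≃-chain = ℜ.trans (ℜ.sym (clear a)) (ℜ.trans (ℜ.*-congˡ {ι (+ n)} ⟪ eq ⟫) (clear b))

-- The spectral decomposition given by a frame

module Spectral {G : Graph} (F : IntegralFrame G) where
  open Graph G
  open IntegralFrame F

  module Π = FrameProjections F ℝ-commutativeRing ι ι-+ ι-* ℜ.refl ℜ.refl (1/ℝ norm) (1/ℝ-inverse norm)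

  P : Fin count → Matrix order
  P i x y = 1/ℝ norm * ι (scaledP i x y)

  μ-apart : ∀ i k → k ≢ i → ι (μ i) # ι (μ k)
  μ-apart i k k≢i with Fin.<-cmp i k
  ... | tri< i<k _ _ = inj₁ (ι-mono-< (increasing i k i<k))
  ... | tri≈ _ i≡k _ = contradiction (≡.sym i≡k) k≢i
  ... | tri> _ _ k<i = inj₂ (ι-mono-< (increasing k i k<i))

  separated : ∀ i k → k ≢ i → ∀ x → ι (μ i) * x ≃ ι (μ k) * x → x ≃ 0ℝ
  separated i k k≢i = #-separates (μ-apart i k k≢i)

  spectrum : ∀ ν → IsEigenvalue adjacency ν → ∃ λ i → ν ≃ ι (μ i)
  spectrum ν (v , (x , vx#0) , Av≈νv) = located (sum-nonzero (λ i → (P i · v) x) vx≠0)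
    where
    vx≠0 : Nonzero (sum λ i → (P i · v) x)
    vx≠0 = nonzero-resp-≃ (ℜ.trans {v x - 0ℝ} (pointwise λ n → ℚ.+-identityʳ (seq (v x) n)) (Π.sum-P v x)) (#⇒nonzero (v x) 0ℝ vx#0)
    located : (∃ λ i → Nonzero ((P i · v) x)) → ∃ λ i → ν ≃ ι (μ i)
    located (i , Pv≠0) = i , *-cancelʳ-nonzero ν (ι (μ i)) ((P i · v) x) Pv≠0
      (Π.P-eigen i ν v (λ y → ⟪ Av≈νv y ⟫) x)

  decomposition : SpectralDecomposition G
  decomposition = record
    { count        = count
    ; μ            = λ i → ι (μ i)
    ; increasing   = λ i j i<j → ι-mono-< (increasing i j i<j)
    ; isEigenvalue = λ i → let (j , x , 0<bx) = positive i in
        Π.B i j , (x , inj₂ (ι-mono-< 0<bx)) , λ x → Π.B-eigen i j x .unwrap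
    ; exhaustive   = λ ν e → let (i , ν≃μ) = spectrum ν e in i , ν≃μ .unwrap
    ; multiplicity = mult
    ; basis        = Π.B
    ; isBasis      = λ i → record
      { member      = λ j x → Π.B-eigen i j x .unwrap
      ; independent = λ c c≈0 j → Π.B-independent i c (λ x → ⟪ c≈0 x ⟫) j .unwrap
      ; spanning    = λ v Av≈μv → (λ j → Π.coeff i j v) , λ x →
          Π.B-spanning separated i v (λ y → ⟪ Av≈μv y ⟫) x .unwrap
      }
    ; P            = P
    ; isProjection = λ i → record
      { image    = λ v x → Π.P-image i v x .unwrap
      ; residual = λ v w Aw≈μw → Π.P-residual separated i v w (λ y → ⟪ Aw≈μw y ⟫) .unwrap
      }
    }

-- Multisets and color refinement

map⁺ : {A B : Set} {R : Rel A 0ℓ} {S : Rel B 0ℓ} {f : A → B} →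
       (∀ {x y} → R x y → S (f x) (f y)) →
       ∀ {xs ys} → Permutation R xs ys → Permutation S (map f xs) (map f ys)
map⁺ f-resp (Homogeneous.refl xs≈ys)     = Homogeneous.refl (Pointwise.map⁺ _ _ (Pointwise.map f-resp xs≈ys))
map⁺ f-resp (Homogeneous.prep x≈y p)     = Homogeneous.prep (f-resp x≈y) (map⁺ f-resp p)
map⁺ f-resp (Homogeneous.swap x≈ y≈ p)   = Homogeneous.swap (f-resp x≈) (f-resp y≈) (map⁺ f-resp p)
map⁺ f-resp (Homogeneous.trans p q)      = Homogeneous.trans (map⁺ f-resp p) (map⁺ f-resp q)

-- Applied at both levels of the nested multiset of `F-strong`, to carry one occurrence from a graph
-- to the other.
any-resp : {A : Set} {R : Rel A 0ℓ} {P : A → Set} → (∀ {x y} → R x y → P x → P y) →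
           ∀ {xs ys} → Permutation R xs ys → Any P xs → Any P ys
any-resp resp (Homogeneous.refl (x≈y ∷ _))  (here px)          = here (resp x≈y px)
any-resp resp (Homogeneous.refl (_ ∷ xs≈ys)) (there pxs)       = there (any-resp resp (Homogeneous.refl xs≈ys) pxs)
any-resp resp (Homogeneous.prep x≈y p)     (here px)           = here (resp x≈y px)
any-resp resp (Homogeneous.prep x≈y p)     (there pxs)         = there (any-resp resp p pxs)
any-resp resp (Homogeneous.swap x≈ y≈ p)   (here px)           = there (here (resp x≈ px))
any-resp resp (Homogeneous.swap x≈ y≈ p)   (there (here px))   = here (resp y≈ px)
any-resp resp (Homogeneous.swap x≈ y≈ p)   (there (there pxs)) = there (there (any-resp resp p pxs))
any-resp resp (Homogeneous.trans p q)      pxs                 = any-resp resp q (any-resp resp p pxs)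

-- If the entry of x depends only on its class f x, then a multiset of entries
-- is determined by the multiset of classes.
map-factors : {A B C : Set} {R : Rel B 0ℓ} {F : A → B} {H : C → B} {f : A → C} →
              Reflexive R → (∀ x → R (F x) (H (f x))) →
              ∀ {xs cs} → map f xs ↭ cs → Permutation R (map F xs) (map H cs)
map-factors {R = R} {F} {H} {f} R-refl F≈Hf {xs} fxs↭cs = Homogeneous.trans
  (Homogeneous.refl (entries xs))
  (map⁺ (λ { refl → R-refl }) (↭⇒↭ₛ fxs↭cs))
  where
  entries : ∀ xs → Pointwise R (map F xs) (map H (map f xs))
  entries []       = []
  entries (x ∷ xs) = F≈Hf x ∷ entries xs

same-refl : {A : Set} {R : Rel A 0ℓ} → Reflexive R → Reflexive (SameMultiset R)
same-refl R-refl = Homogeneous.refl (Pointwise.refl R-refl)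

module _ {B : Set} where

  -- Colors contain multisets of colors, so these proofs recurse jointly through colors and lists or
  -- permutations, keeping the recursion visibly structural.
  ≈ᶜ-refl : Reflexive (_≈ᶜ_ {B})
  ≈ᶜ-refl′ : ∀ {cs : List (Color B)} → Pointwise _≈ᶜ_ cs cs

  ≈ᶜ-refl {initial b}    = initial refl
  ≈ᶜ-refl {refined c cs} = refined ≈ᶜ-refl (Homogeneous.refl ≈ᶜ-refl′)

  ≈ᶜ-refl′ {[]}     = []
  ≈ᶜ-refl′ {c ∷ cs} = ≈ᶜ-refl ∷ ≈ᶜ-refl′

  ≈ᶜ-sym : Symmetric (_≈ᶜ_ {B})
  same-≈ᶜ-sym : Symmetric (SameMultiset (_≈ᶜ_ {B}))
  pointwise-≈ᶜ-sym : Symmetric (Pointwise (_≈ᶜ_ {B}))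

  ≈ᶜ-sym (initial b≡c)     = initial (≡.sym b≡c)
  ≈ᶜ-sym (refined c≈d cs≈ds) = refined (≈ᶜ-sym c≈d) (same-≈ᶜ-sym cs≈ds)

  same-≈ᶜ-sym (Homogeneous.refl cs≈ds)    = Homogeneous.refl (pointwise-≈ᶜ-sym cs≈ds)
  same-≈ᶜ-sym (Homogeneous.prep c≈d p)    = Homogeneous.prep (≈ᶜ-sym c≈d) (same-≈ᶜ-sym p)
  same-≈ᶜ-sym (Homogeneous.swap c≈ d≈ p)  = Homogeneous.swap (≈ᶜ-sym d≈) (≈ᶜ-sym c≈) (same-≈ᶜ-sym p)
  same-≈ᶜ-sym (Homogeneous.trans p q)     = Homogeneous.trans (same-≈ᶜ-sym q) (same-≈ᶜ-sym p)

  pointwise-≈ᶜ-sym []              = []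
  pointwise-≈ᶜ-sym (c≈d ∷ cs≈ds)   = ≈ᶜ-sym c≈d ∷ pointwise-≈ᶜ-sym cs≈ds

-- The colors of the quotient by an equitable partition: nbrs k lists the cells
-- of the neighbours of a vertex in cell k.
module _ {B C : Set} (label : C → B) (nbrs : C → List C) where

  cellColor : ℕ → C → Color B
  cellColor zero    k = initial (label k)
  cellColor (suc r) k = refined (cellColor r k) (map (cellColor r) (nbrs k))

  module _ (G : Graph) (c : Graph.V G → B) (cell : Graph.V G → C)
           (labelled : ∀ y → c y ≡ label (cell y))
           (equitable : ∀ y → map cell (Graph.neighbours G y) ↭ nbrs (cell y)) where
    open Graph G

    -- Induction on the round: the colors of the neighbours factor through their cells, whose
    -- multiset is fixed by the cell of `y`.
    refine-cellColor : ∀ r y → refine G c r y ≈ᶜ cellColor r (cell y)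
    refine-cellColor zero    y = initial (labelled y)
    refine-cellColor (suc r) y = refined (refine-cellColor r y)
      (map-factors ≈ᶜ-refl (refine-cellColor r) (equitable y))

    WL₁-cellColor : ∀ {cs} → map cell vertices ↭ cs →
                    SameMultiset _≈ᶜ_ (WL₁ G c) (map (cellColor order) cs)
    WL₁-cellColor = map-factors ≈ᶜ-refl (refine-cellColor order)

-- A code of pairs of vertices such that, for every x, coding y relative to x is
-- an equitable partition whose quotient depends only on the kind of x.
record VertexCode {κ γ : Set} (marked : γ → Bool) (nbrs : κ → γ → List γ)
                  (codes : List γ) (kinds : List κ) (G : Graph) : Set where
  open Graph G
  field
    code          : V → V → γ
    kind          : V → κ
    individual    : ∀ x y → individualize G x y ≡ marked (code x y)
    equitable     : ∀ x y → map (code x) (neighbours y) ↭ nbrs (kind x) (code x y)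
    code-counts   : ∀ x → map (code x) vertices ↭ codes
    kind-counts   : map kind vertices ↭ kinds

module _ {κ γ : Set} {marked : γ → Bool} {nbrs : κ → γ → List γ} {codes : List γ} {kinds : List κ} where

  -- Two uses of `map-factors`: within one individualization through the codes, across the
  -- individualizations through the kinds.
  WL₃/₂-quotient : ∀ {G} → VertexCode marked nbrs codes kinds G →
    WL₃/₂ G ≈ᵂ map (λ k → map (cellColor marked (nbrs k) (Graph.order G)) codes) kinds
  WL₃/₂-quotient {G} c = map-factors (same-refl ≈ᶜ-refl)
    (λ x → WL₁-cellColor marked (nbrs (kind x)) G (individualize G x) (code x)
      (individual x) (equitable x) (code-counts x))
    kind-counts
    where open VertexCode c

  WL₃/₂-same-code : ∀ {G H} → VertexCode marked nbrs codes kinds G → VertexCode marked nbrs codes kinds H →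
    Graph.order G ≡ Graph.order H → WL₃/₂ G ≈ᵂ WL₃/₂ H
  WL₃/₂-same-code {G} {H} c d orders = Homogeneous.trans (WL₃/₂-quotient c)
    -- The number of rounds is the order, the only trace of the graph left in the quotient.
    (subst (λ n → map (λ k → map (cellColor marked (nbrs k) n) codes) kinds ≈ᵂ WL₃/₂ H) (≡.sym orders)
      (Homogeneous.sym same-≈ᶜ-sym (WL₃/₂-quotient d)))

-- Comparing the spectral invariants

≈⋆-refl : Reflexive _≈⋆_
≈⋆-refl = Pointwise.refl λ {x} → (CommutativeRing.refl ℝ-commutativeRing {x}) .unwrap

≈⋆-trans : ∀ {xs ys zs} → xs ≈⋆ ys → ys ≈⋆ zs → xs ≈⋆ zs
≈⋆-trans = Pointwise.transitive λ {x y z} → ≈-trans {x} {y} {z}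

≈⋆-sym : ∀ {xs ys} → xs ≈⋆ ys → ys ≈⋆ xs
≈⋆-sym = Pointwise.symmetric λ {x y} → ≈-sym {x} {y}

weak-row-sym : Symmetric (Product.Pointwise _≈⋆_ (SameMultiset _≈⋆_))
weak-row-sym (p , r) = ≈⋆-sym p , Homogeneous.sym ≈⋆-sym r

open SpectralDecomposition using (P⋆)

strong⇒weak : ∀ G H (D : SpectralDecomposition G) (E : SpectralDecomposition H) →
              F-strong D ≈ˢ F-strong E → F-weak D ≈ʷ F-weak E
strong⇒weak G H D E (spec≈ , rows≈) = spec≈ ,
  subst₂ (SameMultiset _) (forget-rows D) (forget-rows E)
    (map⁺ (λ { (p≈q , r≈s) → p≈q , map⁺ proj₁ r≈s }) rows≈)
  where
  forget : List ℝ × List (List ℝ × List ℝ) → List ℝ × List (List ℝ)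
  forget (p , row) = p , map proj₁ row
  forget-rows : ∀ {K} (D : SpectralDecomposition K) → map forget (F-strong D .proj₂) ≡ F-weak D .proj₂
  forget-rows {K} D = ≡.trans (≡.sym (map-∘ vertices)) (map-cong (λ x → cong (P⋆ D x x ,_) (≡.sym (map-∘ vertices))) vertices)
    where
    open Graph K using (vertices)

tableRow : ∀ {m} (n : ℕ) → {{ℕ.NonZero n}} → (Fin m → ℤ) → List ℝ
tableRow n row = tabulate λ i → 1/ℝ n * ι (row i)

module _ {κ γ : Set} {marked : γ → Bool} {nbrs : κ → γ → List γ} {codes : List γ} {kinds : List κ}
         {G : Graph} (vertexCode : VertexCode marked nbrs codes kinds G) (F : IntegralFrame G) where
  open Graph G
  open VertexCode vertexCode
  open IntegralFrame F
  open Spectral F using (decomposition)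

  -- The entries of `F-weak` depend only on the kind of `x` and the code of `y`. The entry `P⋆ y y`
  -- of `F-strong` escapes this argument, as it may depend on the kind of `y`.
  F-weak-table : (diagonal : γ) (table : κ → γ → Fin count → ℤ) →
    (∀ x → code x x ≡ diagonal) → (∀ x y i → scaledP i x y ≡ table (kind x) (code x y) i) →
    SameMultiset (Product.Pointwise _≈⋆_ (SameMultiset _≈⋆_))
      (F-weak decomposition .proj₂)
      (map (λ k → tableRow norm (table k diagonal) , map (λ c → tableRow norm (table k c)) codes) kinds)
  F-weak-table diagonal table code-diagonal tabulated = map-factors (≈⋆-refl , same-refl ≈⋆-refl)
    (λ x → subst (λ c → P⋆ decomposition x x ≈⋆ tableRow norm (table (kind x) c)) (code-diagonal x) (row x x) ,
           map-factors ≈⋆-refl (row x) (code-counts x))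
    kind-counts
    where
    row : ∀ x y → P⋆ decomposition x y ≈⋆ tableRow norm (table (kind x) (code x y))
    row x y = Pointwise.tabulate⁺ λ i →
      CommutativeRing.reflexive ℝ-commutativeRing (cong (λ z → 1/ℝ norm * ι z) (tabulated x y i)) .unwrap

-- `Row` and `Entry` express that the three vectors of the pair occur in the nested multiset. This
-- property respects equality of multisets, and its occurrence on the side of `E` yields the new
-- pair.
F-strong-pairs : ∀ {G H} (D : SpectralDecomposition G) (E : SpectralDecomposition H) →
  F-strong D ≈ˢ F-strong E → ∀ x y → ∃ λ x′ → ∃ λ y′ →
    (P⋆ D x x ≈⋆ P⋆ E x′ x′) × (P⋆ D x y ≈⋆ P⋆ E x′ y′) × (P⋆ D y y ≈⋆ P⋆ E y′ y′)
F-strong-pairs D E (_ , rows≈) x y =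
  let x′ , xx≈ , row  = Any.satisfied (Any.map⁻ (any-resp Row-resp rows≈ (Any.map⁺ (at x (≈⋆-refl , Any.map⁺ (at y (≈⋆-refl , ≈⋆-refl)))))))
      y′ , xy≈ , yy≈  = Any.satisfied (Any.map⁻ row)
  in x′ , y′ , xx≈ , xy≈ , yy≈
  where
  at : ∀ {n} {Q : Fin n → Set} x → Q x → Any Q (allFin n)
  at x q = Any.map (λ { refl → q }) (∈-allFin x)
  Entry : List ℝ × List ℝ → Set
  Entry (p , q) = (P⋆ D x y ≈⋆ p) × (P⋆ D y y ≈⋆ q)
  Row : List ℝ × List (List ℝ × List ℝ) → Set
  Row (p , row) = (P⋆ D x x ≈⋆ p) × Any Entry row
  Row-resp : ∀ {r s} → Product.Pointwise _≈⋆_ (SameMultiset (Product.Pointwise _≈⋆_ _≈⋆_)) r s → Row r → Row s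
  Row-resp (p≈q , r≈s) (xx≈p , pairs) = ≈⋆-trans xx≈p p≈q ,
    any-resp (λ { (a≈c , b≈d) (xy≈a , yy≈b) → ≈⋆-trans xy≈a a≈c , ≈⋆-trans yy≈b b≈d }) r≈s pairs

-- The two graphs

-- Reduces a permutation to an equality of lists, which evaluation decides.
↭-by-sorting : ∀ {xs ys} → sort xs ≡ sort ys → xs ↭ ys
↭-by-sorting {xs} {ys} eq = ↭-trans (↭-sym (sort-↭ xs)) (↭-trans (↭-reflexive eq) (sort-↭ ys))

-- A vertex is a position in ℤ/6 within one of four blocks.
block : Fin 24 → Fin 4
block = Fin.quotient {4} 6

position : Fin 24 → Fin 6
position = Fin.remainder {4} 6

-- The position of y relative to x in the same block, 6 if the blocks of x and y
-- are joined (0 to 1, 2 to 3), and 7 otherwise.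
code : Fin 24 → Fin 24 → ℕ
code x y =
  if p ≡ᵇ q then ((6 ℕ.+ toℕ (position y)) ∸ toℕ (position x)) % 6
  else (if p / 2 ≡ᵇ q / 2 then 6 else 7)
  where
  p q : ℕ
  p = toℕ (block x)
  q = toℕ (block y)

codes : List ℕ
codes = upTo 6 ++ replicate 6 6 ++ replicate 12 7

-- Step 1 makes the block a hexagon, step 2 a pair of triangles.
joined : ℕ → ℕ → Bool
joined step c = (c ≡ᵇ step) ∨ (c ≡ᵇ 6 ∸ step) ∨ (c ≡ᵇ 6)

-- Codes, relative to x, of the neighbours of a vertex with code c; step is that
-- of the block of x.
codeNeighbours : ℕ → ℕ → List ℕ
codeNeighbours step 6 = 6 ∷ 6 ∷ upTo 6
codeNeighbours step 7 = replicate 8 7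
codeNeighbours step c = (c ℕ.+ step) % 6 ∷ (c ℕ.+ 6 ∸ step) % 6 ∷ replicate 6 6

-- cos₂ d = 2 cos (π d / 3)
cos₂ : ℕ → ℤ
cos₂ d = Vec.lookup (+ 2 ∷ + 1 ∷ -1ℤ ∷ -[1+ 1 ] ∷ -1ℤ ∷ + 1 ∷ []) (d mod 6)

-- A function on the blocks times one on ℤ/6. `weight` is 12 over the squared length of `entry`: 12
-- for constants on two blocks, and on one block 6 for alternating, 12 for cosine and 4 for sine
-- waves, the latter scaled by 2/√3.
record Mode : Set where
  constructor mode
  field
    weight  : ℤ
    profile : Vec ℤ 4
    wave    : Vec ℤ 6

  entry : Fin 24 → ℤ
  entry x = Vec.lookup profile (block x) ℤ.* Vec.lookup wave (position x)

open Mode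

on : Fin 4 → Vec ℤ 4
on p = Vec.tabulate λ q → if does (p Fin.≟ q) then 1ℤ else 0ℤ

constant alternating : Vec ℤ 4 → Mode
constant    v = mode (+ 1) v (Vec.replicate 6 1ℤ)
alternating v = mode (+ 2) v (+ 1 ∷ -1ℤ ∷ + 1 ∷ -1ℤ ∷ + 1 ∷ -1ℤ ∷ [])

-- The real and imaginary parts of the characters of ℤ/6 of order 6 and 3.
slow fast : Vec ℤ 4 → List Mode
slow v = mode (+ 1) v (+ 2 ∷ + 1 ∷ -1ℤ ∷ -[1+ 1 ] ∷ -1ℤ ∷ + 1 ∷ [])
       ∷ mode (+ 3) v (0ℤ ∷ + 1 ∷ + 1 ∷ 0ℤ ∷ -1ℤ ∷ -1ℤ ∷ []) ∷ []
fast v = mode (+ 1) v (+ 2 ∷ -1ℤ ∷ -1ℤ ∷ + 2 ∷ -1ℤ ∷ -1ℤ ∷ [])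
       ∷ mode (+ 3) v (0ℤ ∷ + 1 ∷ -1ℤ ∷ 0ℤ ∷ + 1 ∷ -1ℤ ∷ []) ∷ []

-- Constants on a joined pair give 2 ± 6. Every other wave sums to 0 over its block, so the join
-- drops out and frequency k has eigenvalue 2 cos (π k s / 3) at step s: for k = 1, 2, 3 this is 1,
-- -1, -2 at step 1 and -1, -1, 2 at step 2.
eigenvalue : Fin 6 → ℤ
eigenvalue = Vec.lookup (-[1+ 3 ] ∷ -[1+ 1 ] ∷ -1ℤ ∷ + 1 ∷ + 2 ∷ + 8 ∷ [])

modes : (Fin 4 → ℕ) → Fin 6 → List Mode
modes step = Vec.lookup
  ( (constant (+ 1 ∷ -1ℤ ∷ 0ℤ ∷ 0ℤ ∷ []) ∷ constant (0ℤ ∷ 0ℤ ∷ + 1 ∷ -1ℤ ∷ []) ∷ [])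
  ∷ map alternating (blocksOf 1)
  ∷ (concatMap fast (blocksOf 1) ++ concatMap fast (blocksOf 2) ++ concatMap slow (blocksOf 2))
  ∷ concatMap slow (blocksOf 1)
  ∷ map alternating (blocksOf 2)
  ∷ (constant (+ 1 ∷ + 1 ∷ 0ℤ ∷ 0ℤ ∷ []) ∷ constant (0ℤ ∷ 0ℤ ∷ + 1 ∷ + 1 ∷ []) ∷ [])
  ∷ [])
  where
  blocksOf : ℕ → List (Vec ℤ 4)
  blocksOf s = map on (filterᵇ (λ p → step p ≡ᵇ s) (allFin 4))

-- 12 · P i x y, by the step of the block of x and the code of y relative to x.
table : ℕ → ℕ → Fin 6 → ℤ
table _ 6 i = Vec.lookup (-1ℤ ∷ 0ℤ ∷ 0ℤ ∷ 0ℤ ∷ 0ℤ ∷ 1ℤ ∷ []) i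
table _ 7 i = 0ℤ
table 1 c i = Vec.lookup
  (1ℤ ∷ cos₂ (3 ℕ.* c) ∷ + 2 ℤ.* cos₂ (2 ℕ.* c) ∷ + 2 ℤ.* cos₂ c ∷ 0ℤ ∷ 1ℤ ∷ []) i
table _ c i = Vec.lookup
  (1ℤ ∷ 0ℤ ∷ + 2 ℤ.* cos₂ (2 ℕ.* c) ℤ.+ + 2 ℤ.* cos₂ c ∷ 0ℤ ∷ cos₂ (3 ℕ.* c) ∷ 1ℤ ∷ []) i

adjacent : (Fin 4 → ℕ) → Fin 24 → Fin 24 → Bool
adjacent step x y = joined (step (block x)) (code x y)

-- Which blocks are joined is the only difference between the two graphs: like
-- kinds in graph 0F, unlike kinds in graph 1F.
stepOf : Fin 2 → Fin 4 → ℕ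
stepOf 0F = Vec.lookup (1 ∷ 1 ∷ 2 ∷ 2 ∷ [])
stepOf 1F = Vec.lookup (1 ∷ 2 ∷ 1 ∷ 2 ∷ [])

graph : Fin 2 → Graph
graph g = record
  { order       = 24
  ; adj         = adjacent (stepOf g)
  -- Quantifying over `g` inside the check keeps the decision a closed term, which evaluates; a free
  -- `g` would block it.
  ; symmetric   = from-yes (all? λ g → all? λ x → all? λ y → adjacent (stepOf g) x y Bool.≟ adjacent (stepOf g) y x) g
  ; irreflexive = from-yes (all? λ g → all? λ x → adjacent (stepOf g) x x Bool.≟ false) g
  }

kind : Fin 2 → Fin 24 → ℕ
kind g x = stepOf g (block x)

kinds : List ℕ
kinds = replicate 12 1 ++ replicate 12 2

-- Verification by evaluation

open Graph using (neighbours)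

individualize-code : ∀ g x y → individualize (graph g) x y ≡ (code x y ≡ᵇ 0)
individualize-code g = from-yes (all? λ x → all? λ y → does (y Fin.≟ x) Bool.≟ (code x y ≡ᵇ 0))

code-diagonal : ∀ x → code x x ≡ 0
code-diagonal = from-yes (all? λ x → code x x ℕ.≟ 0)

-- A vertex of code 6 has two neighbours of code 6 and the whole block of `x`, be its own block a
-- hexagon or two triangles; one of code 7 has eight neighbours of code 7. So only the kind of `x`
-- matters, in both graphs alike.
code-equitable : ∀ g x y → map (code x) (neighbours (graph g) y) ↭ codeNeighbours (kind g x) (code x y)
code-equitable g x y = ↭-by-sorting (from-yes (all? λ g → all? λ x → all? λ y →
  ≡-dec ℕ._≟_ (sort (map (code x) (neighbours (graph g) y))) (sort (codeNeighbours (kind g x) (code x y)))) g x y)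

code-distribution : ∀ x → map (code x) (allFin 24) ↭ codes
code-distribution x = ↭-by-sorting (from-yes (all? λ x →
  ≡-dec ℕ._≟_ (sort (map (code x) (allFin 24))) (sort codes)) x)

kind-distribution : ∀ g → map (kind g) (allFin 24) ↭ kinds
kind-distribution g = ↭-by-sorting (from-yes (all? λ g →
  ≡-dec ℕ._≟_ (sort (map (kind g) (allFin 24))) (sort kinds)) g)

vertexCode : ∀ g → VertexCode (_≡ᵇ 0) codeNeighbours codes kinds (graph g)
vertexCode g = record
  { code          = code
  ; kind          = kind g
  ; individual    = individualize-code g
  ; equitable     = code-equitable g
  ; code-counts   = code-distribution
  ; kind-counts   = kind-distribution g
  }

WL₃/₂-equal : WL₃/₂ (graph 1F) ≈ᵂ WL₃/₂ (graph 0F)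
WL₃/₂-equal = WL₃/₂-same-code (vertexCode 1F) (vertexCode 0F) refl

multiplicity : Fin 2 → Fin 6 → ℕ
multiplicity g i = length (modes (stepOf g) i)

modeOf : ∀ g i → Fin (multiplicity g i) → Mode
modeOf g i = lookup (modes (stepOf g) i)

projection : Fin 2 → Fin 6 → Fin 24 → Fin 24 → ℤ
projection g i x y = sumℤ λ j → weight (modeOf g i j) ℤ.* (entry (modeOf g i j) x ℤ.* entry (modeOf g i j) y)

-- By the addition theorem, cosine and sine waves combine to a cosine of the difference of
-- positions, which is what the code records within a block.
projection-table : ∀ g x y i → projection g i x y ≡ table (kind g x) (code x y) i
projection-table = from-yes (all? λ g → all? λ x → all? λ y → all? λ i →
  projection g i x y ℤ.≟ table (kind g x) (code x y) i)

frame : ∀ g → IntegralFrame (graph g)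
frame g = record
  { count      = 6
  ; μ          = eigenvalue
  ; mult       = multiplicity g
  ; b          = λ i j → entry (modeOf g i j)
  ; w          = λ i j → weight (modeOf g i j)
  ; norm       = 12
  ; increasing = from-yes (all? λ i → all? λ j → (i Fin.<? j) →-dec (eigenvalue i ℤ.<? eigenvalue j))
  ; positive   = from-yes (all? λ g → all? λ i → any? λ j → any? λ x → 0ℤ ℤ.<? entry (modeOf g i j) x) g
  ; eigen      = from-yes (all? λ g → all? λ i → all? λ j → all? λ x →
      sumℤ (λ y → (if adjacent (stepOf g) x y then 1ℤ else 0ℤ) ℤ.* entry (modeOf g i j) y)
        ℤ.≟ eigenvalue i ℤ.* entry (modeOf g i j) x) g
  ; orthogonal = from-yes (all? λ g → all? λ i → all? λ j → all? λ k →
      sumℤ (λ x → weight (modeOf g i j) ℤ.* (entry (modeOf g i j) x ℤ.* entry (modeOf g i k) x))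
        ℤ.≟ (if does (j Fin.≟ k) then + 12 else 0ℤ)) g
  ; complete   = from-yes (all? λ g → all? λ x → all? λ y →
      sumℤ (λ i → projection g i x y) ℤ.≟ (if does (x Fin.≟ y) then + 12 else 0ℤ)) g
  }

spectral : ∀ g → SpectralDecomposition (graph g)
spectral g = Spectral.decomposition (frame g)

F-weak-graph : ∀ g → SameMultiset (Product.Pointwise _≈⋆_ (SameMultiset _≈⋆_))
  (F-weak (spectral g) .proj₂)
  (map (λ s → tableRow 12 (table s 0) , map (λ c → tableRow 12 (table s c)) codes) kinds)
F-weak-graph g = F-weak-table (vertexCode g) (frame g) 0 table code-diagonal (projection-table g)

F-weak-equal : F-weak (spectral 1F) ≈ʷ F-weak (spectral 0F)
-- The spectra agree by computation: the multiplicities depend only on the number of blocks of each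
-- step, two of either in both graphs.
F-weak-equal = Homogeneous.refl ≈⋆-refl ,
  Homogeneous.trans (F-weak-graph 1F) (Homogeneous.sym weak-row-sym (F-weak-graph 0F))

-- Index 3F is the eigenvalue 1, which only hexagons have; index 5F is the
-- eigenvalue 8, whose projection vanishes outside the component of x.
no-joined-unlike-blocks : ∀ x y → + 4 ≡ projection 0F 3F x x → + 1 ≡ projection 0F 5F x y →
                          ¬ (0ℤ ≡ projection 0F 3F y y)
no-joined-unlike-blocks = from-yes (all? λ x → all? λ y → (+ 4 ℤ.≟ projection 0F 3F x x) →-dec
  ((+ 1 ℤ.≟ projection 0F 5F x y) →-dec ¬? (0ℤ ℤ.≟ projection 0F 3F y y)))

F-strong-different : ¬ (F-strong (spectral 1F) ≈ˢ F-strong (spectral 0F))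
F-strong-different same = separate (F-strong-pairs (spectral 1F) (spectral 0F) same x₀ y₀)
  where
  x₀ y₀ : Fin 24
  -- In `graph 1F` these lie in a hexagon and in the pair of triangles joined to it.
  x₀ = Fin.combine {4} {6} 0F 0F
  y₀ = Fin.combine {4} {6} 1F 0F
  entries : ∀ {x y x′ y′} → P⋆ (spectral 1F) x y ≈⋆ P⋆ (spectral 0F) x′ y′ →
            ∀ i → projection 1F i x y ≡ projection 0F i x′ y′
  entries {x} {y} {x′} {y′} eq i = 1/ℝ-injective 12 (Pointwise.tabulate⁻
    {f = λ i → 1/ℝ 12 * ι (projection 1F i x y)} {g = λ i → 1/ℝ 12 * ι (projection 0F i x′ y′)} eq i)
  separate : ¬ (∃ λ x → ∃ λ y → (P⋆ (spectral 1F) x₀ x₀ ≈⋆ P⋆ (spectral 0F) x x) ×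
    (P⋆ (spectral 1F) x₀ y₀ ≈⋆ P⋆ (spectral 0F) x y) × (P⋆ (spectral 1F) y₀ y₀ ≈⋆ P⋆ (spectral 0F) y y))
  -- The three integers on the side of `graph 1F` evaluate to 4, 1 and 0.
  separate (x , y , xx≈ , xy≈ , yy≈) = no-joined-unlike-blocks x y
    (entries {x₀} {x₀} {x} {x} xx≈ 3F) (entries {x₀} {y₀} {x} {y} xy≈ 5F) (entries {y₀} {y₀} {y} {y} yy≈ 3F)

theorem6p1 : (∃ λ G → ∃ λ H → WL₃/₂ G ≈ᵂ WL₃/₂ H ×
    Σ (SpectralDecomposition G) λ D → Σ (SpectralDecomposition H) λ E →
    ¬ (F-strong D ≈ˢ F-strong E))
    ×
    ((∀ G H (D : SpectralDecomposition G) (E : SpectralDecomposition H) →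
    F-strong D ≈ˢ F-strong E → F-weak D ≈ʷ F-weak E)
    ×
    (∃ λ G → ∃ λ H →
    Σ (SpectralDecomposition G) λ D → Σ (SpectralDecomposition H) λ E →
    F-weak D ≈ʷ F-weak E × ¬ (F-strong D ≈ˢ F-strong E)))
theorem6p1 =
  (graph 1F , graph 0F , WL₃/₂-equal , spectral 1F , spectral 0F , F-strong-different) ,
  strong⇒weak ,
  (graph 1F , graph 0F , spectral 1F , spectral 0F , F-weak-equal , F-strong-different)
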